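{- Let $k\geq 2$ be an integer. Let $G$ be a connected graph of order $n$, and suppose that $\delta(G)\geq \sqrt{k(k-1)(k+2\sqrt{2k}+2)\,n}$. Then $G$ has a $[2,k]$-ST.
   Context: All graphs are finite and simple. $\delta(G)$ denotes the minimum degree of $G$. For a tree $T$ and an integer $i\geq 0$, $V_i(T)$ is the set of vertices of degree exactly $i$ in $T$. A spanning tree $T$ of $G$ is called a $[2,k]$-ST of $G$ if $\bigcup_{2\leq i\leq k}V_i(T)=\emptyset$, i.e., $T$ has no vertex whose degree lies in $\{2,3,\ldots,k\}$. -}

module Defs where

open import Data.Nat using (ℕ; zero; suc; _+_; _*_; _∸_; _^_; _≤_; _⊓_)
open import Data.Bool using (Bool; true; false; T; if_then_else_)
open import Data.Fin using (Fin)
open import Data.List using (List; []; _∷_; _++_; [_]; length; map; foldr; allFin)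
open import Data.Nat.ListAction using (sum)
open import Data.List.Relation.Unary.Unique.Propositional using (Unique)
open import Data.Product using (Σ; _×_; ∃)
open import Data.Unit using (⊤)
open import Relation.Binary.PropositionalEquality using (_≡_)
open import Relation.Nullary using (¬_)

record Graph (n : ℕ) : Set where
  field
    adj    : Fin n → Fin n → Bool
    sym    : ∀ u v → adj u v ≡ adj v u
    irrefl : ∀ v → adj v v ≡ false
open Graph public

Adj : ∀ {n} → Graph n → Fin n → Fin n → Set
Adj G u v = T (adj G u v)

deg : ∀ {n} → Graph n → Fin n → ℕ
deg {n} G v = sum (map (λ u → if adj G v u then 1 else 0) (allFin n))

-- minimum degree δ(G); for n ≥ 1 this is the minimum of the degrees
-- (the start value n exceeds every degree, which is at most n - 1)
δ : ∀ {n} → Graph n → ℕ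
δ {n} G = foldr (λ v m → deg G v ⊓ m) n (allFin n)

data Walk {n : ℕ} (G : Graph n) : Fin n → Fin n → Set where
  here : ∀ {v} → Walk G v v
  step : ∀ {u w v} → Adj G u w → Walk G w v → Walk G u v

Connected : ∀ {n} → Graph n → Set
Connected {n} G = ∀ (u v : Fin n) → Walk G u v

Chain : ∀ {n} → Graph n → List (Fin n) → Set
Chain G []           = ⊤
Chain G (x ∷ [])     = ⊤
Chain G (x ∷ y ∷ xs) = Adj G x y × Chain G (y ∷ xs)

HasCycle : ∀ {n} → Graph n → Set
HasCycle {n} G =
  Σ (Fin n) λ x → Σ (List (Fin n)) λ ys →
    (2 ≤ length ys) × Unique (x ∷ ys) × Chain G (x ∷ ys ++ [ x ])

Acyclic : ∀ {n} → Graph n → Set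
Acyclic G = ¬ HasCycle G

Subgraph : ∀ {n} → Graph n → Graph n → Set
Subgraph {n} T' G = ∀ (u v : Fin n) → Adj T' u v → Adj G u v

IsSpanningTree : ∀ {n} → Graph n → Graph n → Set
IsSpanningTree T' G = Subgraph T' G × Connected T' × Acyclic T'

Is2kST : ∀ {n} → ℕ → Graph n → Graph n → Set
Is2kST {n} k T' G =
  IsSpanningTree T' G × (∀ (v : Fin n) → ¬ (2 ≤ deg T' v × deg T' v ≤ k))

Has2kST : ∀ {n} → ℕ → Graph n → Set
Has2kST {n} k G = Σ (Graph n) λ T' → Is2kST k T' G

-- d ≥ √( k(k-1)(k + 2√(2k) + 2) n ), stated exactly over ℕ:
-- since both sides are ≥ 0, this is d² ≥ k(k-1)(k+2)n + 2k(k-1)n√(2k),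
-- i.e. with A = k(k-1)(k+2)n:  A ≤ d²  and  (2k(k-1)n)²·2k ≤ (d² - A)².
SqrtBound : ℕ → ℕ → ℕ → Set
SqrtBound k n d =
  (A ≤ d ^ 2) × ((2 * k * (k ∸ 1) * n) ^ 2 * (2 * k) ≤ (d ^ 2 ∸ A) ^ 2)
  where
  A : ℕ
  A = k * (k ∸ 1) * (k + 2) * n

{-# OPTIONS --safe #-}

-- A spanning tree is repaired by moving edges.  Call a vertex deficient if its degree lies in [2 , k].
-- Grow a rooted forest greedily: a covered vertex with at least τ uncovered neighbours, or an uncovered vertex
-- with at least ρ ≈ δ/2 of them, takes all of them as children.  Let C be the set covered when this stops.  Then
-- covered vertices with at least k uncovered neighbours adopt those; the few vertices left over are attached to
-- neighbours in C, and finally the few trees are joined by arbitrary edges of G.  Only the last two steps create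
-- deficient vertices.  Given a deficient w, look at its neighbours z that still hang from their original parent
-- c(z).  Once there are more of them than parents, two share the same parent c, and w lies on c's side of the tree
-- after deleting zc for at least one of these two z, so zc can be replaced by zw.  As the parents have many
-- children they never become deficient.  All counts fit as soon as δ² ≥ 4k²n, which the hypothesis implies.

module Submission where

open import Defs
open import Data.Nat using (ℕ; _≤_)
open import Data.Nat
  using (NonZero; zero; suc; _+_; _*_; _∸_; _^_; _<_; _≤?_; _<?_; z≤n; s≤s; s≤s⁻¹; _⊓_)
open import Data.Nat.DivMod using (_/_; _%_; m≡m%n+[m/n]*n; m%n<n)
open import Data.Nat.ListAction using () renaming (sum to listSum)
open import Data.Nat.Properties hiding (_≟_)
open import Algebra.Properties.CommutativeMonoid.Sum +-0-commutativeMonoid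
  using (sum; sum-cong-≗; sum-replicate-zero; ∑-distrib-+; ∑-comm)
open import Data.Nat.Tactic.RingSolver using (solve-∀)
import Data.Bool
open import Data.Bool using (Bool; true; false; T; not; if_then_else_)
open import Data.Empty using (⊥)
open import Data.Fin using (Fin; zero; suc; _≟_; fromℕ<)
open import Data.Fin.Properties using (any?)
open import Data.List using ([]; _∷_; _++_; [_]; foldr; allFin; tabulate)
open import Data.List.Membership.Propositional using (_∈_)
open import Data.List.Membership.Propositional.Properties using (∈-allFin)
open import Data.List.Properties using (map-tabulate)
open import Data.List.Relation.Unary.All using (All; []; _∷_)
open import Data.List.Relation.Unary.AllPairs using ([]; _∷_)
open import Data.List.Relation.Unary.Any using (here; there)
open import Data.Product using (Σ; ∃; ∃₂; _×_; _,_; proj₁; proj₂)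
open import Data.Sum using (_⊎_; inj₁; inj₂; [_,_]′; map₂)
open import Data.Unit using (⊤; tt)
open import Function using (_∘_; id; mk⇔)
open import Relation.Binary.PropositionalEquality as ≡ using (_≡_; _≢_; refl; cong; cong₂; subst; trans)
open import Relation.Nullary using (¬_; Dec; yes; no; does; contradiction)
open import Relation.Nullary.Decidable using (_×-dec_; _⊎-dec_; ¬?; T?; dec-true; dec-false; does-⇔)
open import Relation.Unary using (Decidable)

-- Finite counting

-- The obstacle is that supply and demand of replaceable edges almost cancel. Let d be the minimum
-- degree. There are at most (k-1)d/(2k²) leftover vertices and d/(2k²) trees, so attaching and
-- joining create a total deficit of at most about (k²-1)d/(2k²), because (k-1)² + 2(k-1) = k² - 1.
-- This lies only d/(2k²) below d/2. A parent may lose an edge for each unit of this total, so τ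
-- must exceed it; a vertex of C has about d - τ neighbours to draw on, and these must exceed the
-- total plus the number of parents. Placing τ at d/2 - d/(2k²) satisfies both. A vertex outside C
-- can have nearly d/2 uncovered neighbours, which would leave it too few usable ones. But leftovers
-- are attached only to vertices of C, so its deficit comes from joining edges alone. Such vertices
-- are served first, when they compete only with this much smaller demand. For k = 2 the hypothesis
-- is exactly δ² ≥ 4k²n.

bit : Bool → ℕ
bit b = if b then 1 else 0

count : ∀ {n} {P : Fin n → Set} → Decidable P → ℕ
count P? = sum (λ i → bit (does (P? i)))

sum-mono : ∀ {n} {f g : Fin n → ℕ} → (∀ i → f i ≤ g i) → sum f ≤ sum g
sum-mono {zero}  f≤g = z≤n
sum-mono {suc n} f≤g = +-mono-≤ (f≤g zero) (sum-mono (f≤g ∘ suc))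

sum-≤ : ∀ {n} {f : Fin n → ℕ} c → (∀ i → f i ≤ c) → sum f ≤ n * c
sum-≤ {zero}  c f≤c = z≤n
sum-≤ {suc n} c f≤c = +-mono-≤ (f≤c zero) (sum-≤ c (f≤c ∘ suc))

sum-<⇒∃ : ∀ {n} {f g : Fin n → ℕ} → sum f < sum g → ∃ λ i → f i < g i
sum-<⇒∃ {f = f} {g} lt with any? (λ i → f i <? g i)
... | yes found = found
... | no none = contradiction (sum-mono (λ i → ≮⇒≥ (λ fi<gi → none (i , fi<gi)))) (<⇒≱ lt)

module _ {n : ℕ} {P Q R : Fin n → Set} (P? : Decidable P) (Q? : Decidable Q) (R? : Decidable R) where

  count-cover : (∀ i → R i → P i ⊎ Q i) → count R? ≤ count P? + count Q?
  count-cover cover = ≤-trans (sum-mono pointwise)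
      (≤-reflexive (∑-distrib-+ {n} (λ i → bit (does (P? i))) (λ i → bit (does (Q? i)))))
    where
    pointwise : ∀ i → bit (does (R? i)) ≤ bit (does (P? i)) + bit (does (Q? i))
    pointwise i with R? i
    ... | no _ = z≤n
    ... | yes r with cover i r
    ...   | inj₁ p rewrite dec-true (P? i) p = s≤s z≤n
    ...   | inj₂ q rewrite dec-true (Q? i) q = m≤n+m 1 _

  count-disjoint : (∀ i → P i → R i) → (∀ i → Q i → R i) → (∀ i → P i → ¬ Q i) →
    count P? + count Q? ≤ count R?
  count-disjoint P⊆R Q⊆R P∩Q=∅ = ≤-trans
      (≤-reflexive (≡.sym (∑-distrib-+ {n} (λ i → bit (does (P? i))) (λ i → bit (does (Q? i)))))) (sum-mono pointwise)
    where
    pointwise : ∀ i → bit (does (P? i)) + bit (does (Q? i)) ≤ bit (does (R? i))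
    pointwise i with P? i | Q? i
    ... | yes p | yes q = contradiction q (P∩Q=∅ i p)
    ... | yes p | no _ rewrite dec-true (R? i) (P⊆R i p) = s≤s z≤n
    ... | no _ | yes q rewrite dec-true (R? i) (Q⊆R i q) = s≤s z≤n
    ... | no _ | no _ = z≤n

module _ {n : ℕ} {P Q : Fin n → Set} (P? : Decidable P) (Q? : Decidable Q) where

  count-mono : (∀ i → P i → Q i) → count P? ≤ count Q?
  count-mono P⊆Q = sum-mono pointwise
    where
    pointwise : ∀ i → bit (does (P? i)) ≤ bit (does (Q? i))
    pointwise i with P? i
    ... | no _ = z≤n
    ... | yes p rewrite dec-true (Q? i) (P⊆Q i p) = s≤s z≤n

count-cong : ∀ {n} {P Q : Fin n → Set} (P? : Decidable P) (Q? : Decidable Q) →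
  (∀ i → P i → Q i) → (∀ i → Q i → P i) → count P? ≡ count Q?
count-cong P? Q? P⊆Q Q⊆P = ≤-antisym (count-mono P? Q? P⊆Q) (count-mono Q? P? Q⊆P)

count-none : ∀ {n} {P : Fin n → Set} (P? : Decidable P) → (∀ i → ¬ P i) → count P? ≡ 0
count-none {n} P? none = ≤-antisym
    (≤-trans (sum-≤ 0 λ i → ≤-reflexive (cong bit (dec-false (P? i) (none i)))) (≤-reflexive (*-zeroʳ n))) z≤n

sum-point : ∀ {n} c (a : Fin n) → sum (λ i → if does (i ≟ a) then c else 0) ≡ c
sum-point {suc n} c zero = trans (cong (c +_) (sum-replicate-zero n)) (+-identityʳ c)
sum-point c (suc a) = sum-point c a

count-point : ∀ {n} (a : Fin n) → count (_≟ a) ≡ 1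
count-point = sum-point 1

count-≤n : ∀ {n} {P : Fin n → Set} (P? : Decidable P) → count P? ≤ n
count-≤n {n} P? = ≤-trans (sum-≤ 1 (λ i → bit≤1 (does (P? i)))) (≤-reflexive (*-identityʳ n))
  where
  bit≤1 : ∀ b → bit b ≤ 1
  bit≤1 false = z≤n
  bit≤1 true = s≤s z≤n

count-insert : ∀ {n} {P Q : Fin n → Set} (P? : Decidable P) (Q? : Decidable Q) (a : Fin n) →
  ¬ P a → Q a → (∀ i → P i → Q i) → (∀ i → Q i → i ≢ a → P i) → count Q? ≡ suc (count P?)
count-insert P? Q? a ¬Pa Qa P⊆Q Q⊆P = trans
  (≤-antisym
    (count-cover P? (_≟ a) Q? cover)
    (count-disjoint P? (_≟ a) Q? P⊆Q (λ { i refl → Qa }) (λ { i p refl → ¬Pa p })))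
  (trans (cong (count P? +_) (count-point a)) (+-comm _ 1))
  where
  cover : ∀ i → _ → _
  cover i q with i ≟ a
  ... | yes i≡a = inj₂ i≡a
  ... | no i≢a = inj₁ (Q⊆P i q i≢a)

count-strict : ∀ {n} {P Q : Fin n → Set} (P? : Decidable P) (Q? : Decidable Q) (a : Fin n) →
  ¬ P a → Q a → (∀ i → P i → Q i) → count P? < count Q?
count-strict P? Q? a ¬Pa Qa P⊆Q = ≤-trans
  (≤-reflexive (trans (+-comm 1 _) (cong (count P? +_) (≡.sym (count-point a)))))
  (count-disjoint P? (_≟ a) Q? P⊆Q (λ { i refl → Qa }) (λ { i p refl → ¬Pa p }))

count-∃ : ∀ {n} {P : Fin n → Set} (P? : Decidable P) → 1 ≤ count P? → ∃ P
count-∃ P? 1≤ with any? P?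
... | yes found = found
... | no none = contradiction (≤-reflexive (count-none P? (λ i p → none (i , p)))) (<⇒≱ 1≤)

count-∃₂ : ∀ {n} {P : Fin n → Set} (P? : Decidable P) → 2 ≤ count P? → ∃₂ λ a b → a ≢ b × P a × P b
count-∃₂ P? 2≤ =
  let a , pa = count-∃ P? (≤-trans (n≤1+n 1) 2≤)
      b , pb , b≢a = count-∃ (λ i → P? i ×-dec ¬? (i ≟ a)) (s≤s⁻¹ (≤-trans 2≤ (one-less a)))
  in a , b , b≢a ∘ ≡.sym , pa , pb
  where
  one-less : ∀ a → count P? ≤ suc (count (λ i → P? i ×-dec ¬? (i ≟ a)))
  one-less a = ≤-trans
    (count-cover (λ i → P? i ×-dec ¬? (i ≟ a)) (_≟ a) P? cover)
    (≤-reflexive (trans (cong (count (λ i → P? i ×-dec ¬? (i ≟ a)) +_) (count-point a)) (+-comm _ 1)))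
    where
    cover : ∀ i → _ → _
    cover i p with i ≟ a
    ... | yes i≡a = inj₂ i≡a
    ... | no i≢a = inj₁ (p , i≢a)

count-swap : ∀ {m n} {R : Fin m → Fin n → Set} (R? : ∀ u v → Dec (R u v)) →
  sum (λ u → count (λ v → R? u v)) ≡ sum (λ v → count (λ u → R? u v))
count-swap R? = ∑-comm (λ u v → bit (does (R? u v)))

count-fibres : ∀ {n} {P : Fin n → Set} (P? : Decidable P) (f : Fin n → Fin n) →
  sum (λ c → count (λ z → P? z ×-dec (c ≟ f z))) ≡ count P?
count-fibres P? f = trans (count-swap (λ c z → P? z ×-dec (c ≟ f z))) (sum-cong-≗ fibre)
  where
  fibre : ∀ z → count (λ c → P? z ×-dec (c ≟ f z)) ≡ bit (does (P? z))
  fibre z with P? z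
  ... | yes p = count-point (f z)
  ... | no ¬p = count-none (λ c → no ¬p ×-dec (c ≟ f z)) λ c (p , _) → ¬p p

-- The fibre sizes add up to the count of `P`, so some fibre is larger than the indicator of `Q` at
-- its base point. Fibres over points outside `Q` are empty, hence this one has two elements.
count-pigeonhole : ∀ {n} {P Q : Fin n → Set} (P? : Decidable P) (Q? : Decidable Q) (f : Fin n → Fin n) →
  (∀ z → P z → Q (f z)) → count Q? < count P? → ∃₂ λ a b → a ≢ b × P a × P b × f a ≡ f b
count-pigeonhole {Q = Q} P? Q? f maps lt = conclude (sum-<⇒∃ (≤-trans lt (≤-reflexive (≡.sym (count-fibres P? f)))))
  where
  conclude : (∃ λ c → bit (does (Q? c)) < count (λ z → P? z ×-dec (c ≟ f z))) → _
  conclude (c , big) with Q? c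
  ... | yes _ =
    let a , b , a≢b , (pa , c≡fa) , (pb , c≡fb) = count-∃₂ (λ z → P? z ×-dec (c ≟ f z)) big
    in a , b , a≢b , pa , pb , trans (≡.sym c≡fa) c≡fb
  ... | no ¬q =
    let z , pz , c≡fz = count-∃ (λ z → P? z ×-dec (c ≟ f z)) big
    in contradiction (subst Q (≡.sym c≡fz) (maps z pz)) ¬q

sum-bump : ∀ {n} {f g : Fin n → ℕ} (w : Fin n) →
  (∀ i → f i ≡ g i + bit (does (i ≟ w))) → sum f ≡ suc (sum g)
sum-bump {n} {g = g} w eq = trans (sum-cong-≗ eq)
  (trans (∑-distrib-+ {n} g (λ i → bit (does (i ≟ w)))) (trans (cong (sum g +_) (count-point w)) (+-comm _ 1)))

term≤sum : ∀ {n} (f : Fin n → ℕ) i → f i ≤ sum f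
term≤sum f zero = m≤m+n _ _
term≤sum f (suc i) = ≤-trans (term≤sum (f ∘ suc) i) (m≤n+m _ _)

count-≥1 : ∀ {n} {P : Fin n → Set} (P? : Decidable P) a → P a → 1 ≤ count P?
count-≥1 P? a pa = ≤-trans (≤-reflexive (≡.sym (count-point a))) (count-mono (_≟ a) P? λ { i refl → pa })

listSum-tabulate : ∀ {n} (f : Fin n → ℕ) → listSum (tabulate f) ≡ sum f
listSum-tabulate {zero}  f = refl
listSum-tabulate {suc n} f = cong (f zero +_) (listSum-tabulate (f ∘ suc))

neighbour? : ∀ {n} (G : Graph n) v u → Dec (Adj G v u)
neighbour? G v u = T? (adj G v u)

deg≡count : ∀ {n} (G : Graph n) v → deg G v ≡ count (neighbour? G v)
deg≡count {n} G v = trans (cong listSum (map-tabulate {n = n} id (λ u → bit (adj G v u))))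
    (listSum-tabulate (λ u → bit (adj G v u)))

-- Graphs and walks

to-does : ∀ {A : Set} (a? : Dec A) → A → T (does a?)
to-does (yes _) a = _
to-does (no ¬a) a = ¬a a

from-does : ∀ {A : Set} (a? : Dec A) → T (does a?) → A
from-does (yes a) _ = a

mkGraph : ∀ {n} {R : Fin n → Fin n → Set} → (∀ u v → Dec (R u v)) →
  (∀ {u v} → R u v → R v u) → (∀ v → ¬ R v v) → Graph n
mkGraph R? R-sym R-irrefl = record
  { adj    = λ u v → does (R? u v)
  ; sym    = λ u v → does-⇔ (mk⇔ R-sym R-sym) (R? u v) (R? v u)
  ; irrefl = λ v → dec-false (R? v v) (R-irrefl v)
  }

module _ {n : ℕ} where

  private
    V = Fin n

  adj-sym : (G : Graph n) → ∀ {u v} → Adj G u v → Adj G v u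
  adj-sym G {u} {v} = subst T (sym G u v)

  adj-irrefl : (G : Graph n) → ∀ {u v} → Adj G u v → u ≢ v
  adj-irrefl G {u} a refl = subst T (irrefl G u) a

  SameEdge : V → V → V → V → Set
  SameEdge a b u v = (u ≡ a × v ≡ b) ⊎ (u ≡ b × v ≡ a)

  sameEdge? : ∀ a b u v → Dec (SameEdge a b u v)
  sameEdge? a b u v = ((u ≟ a) ×-dec (v ≟ b)) ⊎-dec ((u ≟ b) ×-dec (v ≟ a))

  sameEdge-sym : ∀ {a b u v} → SameEdge a b u v → SameEdge a b v u
  sameEdge-sym (inj₁ (p , q)) = inj₂ (q , p)
  sameEdge-sym (inj₂ (p , q)) = inj₁ (q , p)

  addEdge? : (F : Graph n) (x y : V) → ∀ u v → Dec (Adj F u v ⊎ SameEdge x y u v)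
  addEdge? F x y u v = neighbour? F u v ⊎-dec sameEdge? x y u v

  addEdge : (F : Graph n) (x y : V) → x ≢ y → Graph n
  addEdge F x y x≢y = mkGraph (addEdge? F x y)
    (λ { (inj₁ a) → inj₁ (adj-sym F a) ; (inj₂ s) → inj₂ (sameEdge-sym s) })
    (λ { v (inj₁ a) → adj-irrefl F a refl
       ; v (inj₂ (inj₁ (refl , refl))) → x≢y refl
       ; v (inj₂ (inj₂ (refl , refl))) → x≢y refl })

  removeEdge? : (F : Graph n) (a b : V) → ∀ u v → Dec (Adj F u v × ¬ SameEdge a b u v)
  removeEdge? F a b u v = neighbour? F u v ×-dec ¬? (sameEdge? a b u v)

  infixl 7 _∖[_,_]
  _∖[_,_] : Graph n → V → V → Graph n
  F ∖[ a , b ] = mkGraph (removeEdge? F a b)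
    (λ (e , ¬s) → adj-sym F e , ¬s ∘ sameEdge-sym)
    (λ v (e , _) → adj-irrefl F e refl)

  module _ {F : Graph n} where
    add-old : ∀ {x y u v} (x≢y : x ≢ y) → Adj F u v → Adj (addEdge F x y x≢y) u v
    add-old {x} {y} {u} {v} _ e = to-does (addEdge? F x y u v) (inj₁ e)

    add-new : ∀ {x y} (x≢y : x ≢ y) → Adj (addEdge F x y x≢y) x y
    add-new {x} {y} _ = to-does (addEdge? F x y x y) (inj₂ (inj₁ (refl , refl)))

    add-view : ∀ {x y u v} (x≢y : x ≢ y) → Adj (addEdge F x y x≢y) u v → Adj F u v ⊎ SameEdge x y u v
    add-view {x} {y} {u} {v} _ = from-does (addEdge? F x y u v)

    remove-intro : ∀ {a b u v} → Adj F u v → ¬ SameEdge a b u v → Adj (F ∖[ a , b ]) u v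
    remove-intro {a} {b} {u} {v} e ¬s = to-does (removeEdge? F a b u v) (e , ¬s)

    remove-view : ∀ {a b u v} → Adj (F ∖[ a , b ]) u v → Adj F u v × ¬ SameEdge a b u v
    remove-view {a} {b} {u} {v} = from-does (removeEdge? F a b u v)

  module _ {F : Graph n} where
    walk-trans : ∀ {u v w} → Walk F u v → Walk F v w → Walk F u w
    walk-trans here q = q
    walk-trans (step e p) q = step e (walk-trans p q)

    walk-edge : ∀ {u v} → Adj F u v → Walk F u v
    walk-edge e = step e here

    walk-sym : ∀ {u v} → Walk F u v → Walk F v u
    walk-sym here = here
    walk-sym (step e p) = walk-trans (walk-sym p) (walk-edge (adj-sym F e))

    walk-bind : ∀ {H : Graph n} → (∀ {u v} → Adj F u v → Walk H u v) → ∀ {u v} → Walk F u v → Walk H u v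
    walk-bind f here = here
    walk-bind f (step e p) = walk-append (f e) (walk-bind f p)
      where
      walk-append : ∀ {H : Graph n} {u v w} → Walk H u v → Walk H v w → Walk H u w
      walk-append here q = q
      walk-append (step e p) q = step e (walk-append p q)

    walk-closed : (P : V → Set) → (∀ {u v} → Adj F u v → P u → P v) → ∀ {u v} → Walk F u v → P u → P v
    walk-closed P cl here pu = pu
    walk-closed P cl (step e p) pu = walk-closed P cl p (cl e pu)

  walk-map : ∀ {F H : Graph n} → Subgraph F H → ∀ {u v} → Walk F u v → Walk H u v
  walk-map F⊆H = walk-bind (λ {u} {v} e → walk-edge (F⊆H u v e))

  remove-⊆ : ∀ {F : Graph n} {a b} → Subgraph (F ∖[ a , b ]) F
  remove-⊆ {F} u v e = proj₁ (remove-view {F} e)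

  -- The walk is cut just before its first use of the edge, where it stands at one of the two ends.
  walk-split : ∀ {F : Graph n} a b {u v} → Walk F u v →
    Walk (F ∖[ a , b ]) u v ⊎ (Walk (F ∖[ a , b ]) u a ⊎ Walk (F ∖[ a , b ]) u b)
  walk-split a b here = inj₁ here
  walk-split {F} a b (step {u} {w} e p) with sameEdge? a b u w
  ... | yes (inj₁ (refl , _)) = inj₂ (inj₁ here)
  ... | yes (inj₂ (refl , _)) = inj₂ (inj₂ here)
  ... | no ¬s with walk-split a b p
  ...   | inj₁ q = inj₁ (step (remove-intro {F} e ¬s) q)
  ...   | inj₂ (inj₁ q) = inj₂ (inj₁ (step (remove-intro {F} e ¬s) q))
  ...   | inj₂ (inj₂ q) = inj₂ (inj₂ (step (remove-intro {F} e ¬s) q))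

  -- Every edge is a bridge; for the forests built below this is easier to maintain than Acyclic.
  Forest : Graph n → Set
  Forest F = ∀ {a b} → Adj F a b → ¬ Walk (F ∖[ a , b ]) a b

  remove-mono : ∀ {F H : Graph n} {a b} → Subgraph F H → Subgraph (F ∖[ a , b ]) (H ∖[ a , b ])
  remove-mono {F} {H} F⊆H u v e = let e′ , ¬s = remove-view {F} e in remove-intro {H} (F⊆H u v e′) ¬s

  forest-⊆ : ∀ {F H : Graph n} → Subgraph F H → Forest H → Forest F
  forest-⊆ {F} {H} F⊆H forest {a} {b} e p = forest (F⊆H a b e) (walk-map (remove-mono {F} {H} F⊆H) p)

  -- If an old edge ab failed to be a bridge, the detour would have to use xy. Then a and b each
  -- reach an end of xy without ab and xy: the same end would close a detour already in `F`, and
  -- different ends would link x to y in `F` through ab.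
  forest-add : ∀ {F : Graph n} {x y} (x≢y : x ≢ y) → Forest F → ¬ Walk F x y → Forest (addEdge F x y x≢y)
  forest-add {F} {x} {y} x≢y forest ¬xy {a} {b} e p with sameEdge? x y a b
  ... | yes s = apart s (walk-map old p)
    where
    old : Subgraph (addEdge F x y x≢y ∖[ a , b ]) F
    old u v e′ with remove-view {addEdge F x y x≢y} e′
    ... | e″ , ¬s with add-view {F} x≢y e″
    ...   | inj₁ f = f
    ...   | inj₂ s′ = contradiction (same s s′) ¬s
      where
      same : SameEdge x y a b → SameEdge x y u v → SameEdge a b u v
      same (inj₁ (refl , refl)) s′ = s′
      same (inj₂ (refl , refl)) (inj₁ q) = inj₂ q
      same (inj₂ (refl , refl)) (inj₂ q) = inj₁ q
    apart : SameEdge x y a b → ¬ Walk F a b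
    apart (inj₁ (refl , refl)) q = ¬xy q
    apart (inj₂ (refl , refl)) q = ¬xy (walk-sym q)
  ... | no ¬s = impossible (walk-split x y p) (walk-split x y (walk-sym p))
    where
    F′ = addEdge F x y x≢y
    H = F′ ∖[ a , b ] ∖[ x , y ]
    f : Adj F a b
    f = [ id , (λ s → contradiction s ¬s) ]′ (add-view {F} x≢y e)
    H⊆ : Subgraph H (F ∖[ a , b ])
    H⊆ u v e′ with remove-view {F′ ∖[ a , b ]} e′
    ... | e″ , ¬xy′ with remove-view {F′} e″
    ...   | e‴ , ¬ab with add-view {F} x≢y e‴
    ...     | inj₁ g = remove-intro {F} g ¬ab
    ...     | inj₂ s = contradiction s ¬xy′
    low : ∀ {u v} → Walk H u v → Walk (F ∖[ a , b ]) u v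
    low = walk-map H⊆
    low′ : ∀ {u v} → Walk H u v → Walk F u v
    low′ = walk-map (remove-⊆ {F}) ∘ low
    joined : ∀ {u} → Walk H a u → Walk H b u → ⊥
    joined q r = forest f (walk-trans (low q) (walk-sym (low r)))
    linked : ∀ {u v} → Walk H a u → Walk H b v → Walk F u v
    linked q r = walk-trans (walk-sym (low′ q)) (step f (low′ r))
    impossible : Walk H a b ⊎ (Walk H a x ⊎ Walk H a y) → Walk H b a ⊎ (Walk H b x ⊎ Walk H b y) → ⊥
    impossible (inj₁ q) _ = forest f (low q)
    impossible (inj₂ _) (inj₁ q) = forest f (walk-sym (low q))
    impossible (inj₂ (inj₁ q)) (inj₂ (inj₁ r)) = joined q r
    impossible (inj₂ (inj₂ q)) (inj₂ (inj₂ r)) = joined q r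
    impossible (inj₂ (inj₁ q)) (inj₂ (inj₂ r)) = ¬xy (linked q r)
    impossible (inj₂ (inj₂ q)) (inj₂ (inj₁ r)) = ¬xy (walk-sym (linked q r))

  -- The rest of a cycle is a detour around its first edge; distinctness of the vertices ensures
  -- that this edge does not recur.
  forest-acyclic : ∀ {F : Graph n} → Forest F → Acyclic F
  forest-acyclic forest (_ , _ ∷ [] , s≤s () , _)
  forest-acyclic {F} forest (x , y ∷ z ∷ zs , _ , ((x≢y ∷ x≢z ∷ x∉zs) ∷ (y≢z ∷ y∉zs) ∷ _) , (xy , yz , rest)) =
    forest xy (walk-sym (step (remove-intro {F} yz λ { (inj₁ (y≡x , _)) → x≢y (≡.sym y≡x) ; (inj₂ (_ , z≡x)) → x≢z
        (≡.sym z≡x) })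
                              (close z zs (x≢z , y≢z) x∉zs y∉zs rest)))
    where
    close : ∀ u us → x ≢ u × y ≢ u → All (x ≢_) us → All (y ≢_) us → Chain F (u ∷ us ++ [ x ]) → Walk
        (F ∖[ x , y ]) u x
    close u [] (x≢u , y≢u) _ _ (e , _) = step
        (remove-intro {F} e λ { (inj₁ (u≡x , _)) → x≢u (≡.sym u≡x) ; (inj₂ (u≡y , _)) → y≢u (≡.sym u≡y) }) here
    close u (v ∷ us) (x≢u , y≢u) (x≢v ∷ x∉) (y≢v ∷ y∉) (e , es) =
      step (remove-intro {F} e λ { (inj₁ (u≡x , _)) → x≢u (≡.sym u≡x) ; (inj₂ (u≡y , _)) → y≢u (≡.sym u≡y) })
           (close v us (x≢v , y≢v) x∉ y∉ es)

  -- Degrees after adding or deleting an edge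

  deg-cong : ∀ {F H : Graph n} v → (∀ u → Adj F v u → Adj H v u) → (∀ u → Adj H v u → Adj F v u) → deg F v ≡ deg H v
  deg-cong {F} {H} v to from = trans (deg≡count F v)
    (trans (count-cong (neighbour? F v) (neighbour? H v) to from) (≡.sym (deg≡count H v)))

  deg-insert : ∀ {F H : Graph n} v a → ¬ Adj F v a → Adj H v a →
    (∀ u → Adj F v u → Adj H v u) → (∀ u → Adj H v u → u ≢ a → Adj F v u) → deg H v ≡ suc (deg F v)
  deg-insert {F} {H} v a ¬Fa Ha F⊆H H⊆F = trans (deg≡count H v)
    (trans (count-insert (neighbour? F v) (neighbour? H v) a ¬Fa Ha F⊆H H⊆F) (cong suc (≡.sym (deg≡count F v))))

  module _ {F : Graph n} {x y : V} (x≢y : x ≢ y) (¬xy : ¬ Adj F x y) where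
    private F′ = addEdge F x y x≢y

    deg-add-left : deg F′ x ≡ suc (deg F x)
    deg-add-left = deg-insert {F} {F′} x y ¬xy (add-new {F} x≢y) (λ u → add-old {F} x≢y) back
      where
      back : ∀ u → Adj F′ x u → u ≢ y → Adj F x u
      back u e u≢y with add-view {F} x≢y e
      ... | inj₁ f = f
      ... | inj₂ (inj₁ (_ , u≡y)) = contradiction u≡y u≢y
      ... | inj₂ (inj₂ (x≡y , _)) = contradiction x≡y x≢y

    deg-add-right : deg F′ y ≡ suc (deg F y)
    deg-add-right = deg-insert {F} {F′} y x (¬xy ∘ adj-sym F) (adj-sym F′ (add-new {F} x≢y))
        (λ u → add-old {F} x≢y) back
      where
      back : ∀ u → Adj F′ y u → u ≢ x → Adj F y u
      back u e u≢x with add-view {F} x≢y e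
      ... | inj₁ f = f
      ... | inj₂ (inj₁ (y≡x , _)) = contradiction (≡.sym y≡x) x≢y
      ... | inj₂ (inj₂ (_ , u≡x)) = contradiction u≡x u≢x

    deg-add-other : ∀ {v} → v ≢ x → v ≢ y → deg F′ v ≡ deg F v
    deg-add-other {v} v≢x v≢y = deg-cong {F′} {F} v back (λ u → add-old {F} x≢y)
      where
      back : ∀ u → Adj F′ v u → Adj F v u
      back u e with add-view {F} x≢y e
      ... | inj₁ f = f
      ... | inj₂ (inj₁ (v≡x , _)) = contradiction v≡x v≢x
      ... | inj₂ (inj₂ (v≡y , _)) = contradiction v≡y v≢y

  module _ {F : Graph n} {a b : V} (ab : Adj F a b) where
    private a≢b = adj-irrefl F ab

    deg-remove-left : deg F a ≡ suc (deg (F ∖[ a , b ]) a)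
    deg-remove-left = deg-insert {F ∖[ a , b ]} {F} a b (λ e → proj₂ (remove-view {F} e) (inj₁ (refl , refl))) ab
      (λ u e → proj₁ (remove-view {F} e))
      (λ u e u≢b → remove-intro {F} e λ { (inj₁ (_ , u≡b)) → u≢b u≡b ; (inj₂ (a≡b , _)) → a≢b a≡b })

    deg-remove-right : deg F b ≡ suc (deg (F ∖[ a , b ]) b)
    deg-remove-right = deg-insert {F ∖[ a , b ]} {F} b a (λ e → proj₂ (remove-view {F} e) (inj₂ (refl , refl)))
        (adj-sym F ab)
      (λ u e → proj₁ (remove-view {F} e))
      (λ u e u≢a → remove-intro {F} e λ { (inj₁ (b≡a , _)) → a≢b (≡.sym b≡a) ; (inj₂ (_ , u≡a)) → u≢a u≡a })

    deg-remove-other : ∀ {v} → v ≢ a → v ≢ b → deg F v ≡ deg (F ∖[ a , b ]) v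
    deg-remove-other {v} v≢a v≢b = deg-cong {F} {F ∖[ a , b ]} v
      (λ u e → remove-intro {F} e λ { (inj₁ (v≡a , _)) → v≢a v≡a ; (inj₂ (v≡b , _)) → v≢b v≡b })
      (λ u e → proj₁ (remove-view {F} e))

-- Deficits

-- The number of edges that a vertex of degree d lacks to leave the forbidden range [2 , k].
deficit : ℕ → ℕ → ℕ
deficit k (suc (suc d)) = k ∸ suc d
deficit k _ = 0

deficit-≤ : ∀ k d → deficit k d ≤ k ∸ 1
deficit-≤ k 0 = z≤n
deficit-≤ k 1 = z≤n
deficit-≤ k (suc (suc d)) = ∸-monoʳ-≤ k (s≤s z≤n)

deficit-large : ∀ {k d} → k < d → deficit k d ≡ 0
deficit-large {d = 1} _ = refl
deficit-large {d = suc (suc d)} (s≤s k≤1+d) = m≤n⇒m∸n≡0 k≤1+d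

deficit-zero : ∀ {k d} → deficit k d ≡ 0 → ¬ (2 ≤ d × d ≤ k)
deficit-zero {k} {suc (suc d)} eq (_ , 2+d≤k) = <⇒≱ 2+d≤k (m∸n≡0⇒m≤n eq)
deficit-zero {k} {1} _ (s≤s () , _)

deficit-suc : ∀ {k d} → 1 ≤ deficit k d → deficit k d ≡ suc (deficit k (suc d)) × d ≤ k
deficit-suc {k} {suc (suc d)} pos = +-∸-assoc 1 lt , lt
  where
  lt : suc d < k
  lt = ≰⇒> (λ k≤1+d → <⇒≱ pos (≤-reflexive (m≤n⇒m∸n≡0 k≤1+d)))

-- The selector `Q` lets the total be split into vertices outside C and vertices of C, which have
-- different supplies.
shortage : ∀ {n} → ℕ → (Fin n → Bool) → Graph n → ℕ
shortage k Q T = sum (λ v → if Q v then deficit k (deg T v) else 0)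

module _ {n : ℕ} where
  private V = Fin n

  -- Only the two ends change degree, and whatever their new degrees are, each deficit is at most k
  -- - 1.
  shortage-add : ∀ k (Q : V → Bool) (F : Graph n) {x y} (x≢y : x ≢ y) → ¬ Adj F x y →
    shortage k Q (addEdge F x y x≢y) ≤ shortage k Q F + 2 * (k ∸ 1)
  shortage-add k Q F {x} {y} x≢y ¬xy = begin
    sum new                            ≤⟨ sum-mono pointwise ⟩
    sum (λ v → old v + (at x v + at y v))  ≡⟨ ∑-distrib-+ {n} old (λ v → at x v + at y v) ⟩
    sum old + sum (λ v → at x v + at y v)  ≡⟨ cong (sum old +_) (∑-distrib-+ {n} (at x) (at y)) ⟩
    sum old + (sum (at x) + sum (at y))    ≡⟨ cong (sum old +_) (cong₂ _+_ (sum-point _ x) (sum-point _ y)) ⟩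
    sum old + (c + c)                      ≡⟨ cong (λ t → sum old + (c + t)) (≡.sym (+-identityʳ c)) ⟩
    sum old + 2 * c                        ∎
    where
    open ≤-Reasoning
    c = k ∸ 1
    F′ = addEdge F x y x≢y
    new old : V → ℕ
    new v = if Q v then deficit k (deg F′ v) else 0
    old v = if Q v then deficit k (deg F v) else 0
    at : V → V → ℕ
    at a v = if does (v ≟ a) then c else 0
    pointwise : ∀ v → new v ≤ old v + (at x v + at y v)
    pointwise v with Q v
    ... | false = z≤n
    ... | true = by-cases (v ≟ x) (v ≟ y)
      where
      c≤at : ∀ a → v ≡ a → c ≤ at a v
      c≤at a v≡a = ≤-reflexive (≡.sym (cong (λ b → if b then c else 0) (dec-true (v ≟ a) v≡a)))
      by-cases : Dec (v ≡ x) → Dec (v ≡ y) → deficit k (deg F′ v) ≤ deficit k (deg F v) + (at x v + at y v)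
      by-cases (yes v≡x) _ = ≤-trans (deficit-≤ k (deg F′ v))
        (≤-trans (c≤at x v≡x) (≤-trans (m≤m+n _ _) (m≤n+m _ (deficit k (deg F v)))))
      by-cases (no _) (yes v≡y) = ≤-trans (deficit-≤ k (deg F′ v))
        (≤-trans (c≤at y v≡y) (≤-trans (m≤n+m _ (at x v)) (m≤n+m _ (deficit k (deg F v)))))
      by-cases (no v≢x) (no v≢y) =
        ≤-trans (≤-reflexive (cong (deficit k) (deg-add-other {F = F} x≢y ¬xy v≢x v≢y))) (m≤m+n _ _)

  -- Joining the components of a forest

  -- Explicit labels make it decidable whether two vertices are connected, and reduce a merge of
  -- components to a relabelling.
  record Components (F : Graph n) : Set where
    field
      label       : V → V
      label-adj   : ∀ {u v} → Adj F u v → label u ≡ label v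
      label-walk  : ∀ {u v} → label u ≡ label v → Walk F u v

  record SpanningTree (G T : Graph n) : Set where
    field
      within    : Subgraph T G
      forest    : Forest T
      connected : Connected T

  walk-crossing : ∀ {G : Graph n} (f : V → V) {u v} → Walk G u v → f u ≢ f v →
    ∃₂ λ x y → Adj G x y × f x ≢ f y
  walk-crossing f here fu≢fv = contradiction refl fu≢fv
  walk-crossing f (step {u} {w} e p) fu≢fv with f u ≟ f w
  ... | no fu≢fw = u , w , e , fu≢fw
  ... | yes fu≡fw = walk-crossing f p (fu≢fv ∘ trans fu≡fw)

  -- The bound is uniform in `Q` because it is applied to the same tree twice: to the vertices
  -- outside C and to all vertices.
  JoinedWithin : ℕ → Graph n → Graph n → ℕ → Set
  JoinedWithin k G F N = ∃ λ T → SpanningTree G T × Subgraph F T ×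
    (∀ Q → shortage k Q T ≤ shortage k Q F + N * (2 * (k ∸ 1)))

  -- Every joining edge retires one label from `Rep`, so N + 1 admissible labels allow at most N
  -- joins.
  join-components : ∀ k {G : Graph n} → Connected G → ∀ N {F} → Subgraph F G → Forest F → (C : Components F) →
    {Rep : V → Set} (rep? : Decidable Rep) → (∀ v → Rep (Components.label C v)) → count rep? ≤ suc N →
    JoinedWithin k G F N
  join-components k {G} connected N {F} F⊆G forest C {Rep} rep? rep few
    with any? (λ u → any? (λ v → ¬? (Components.label C u ≟ Components.label C v)))
  ... | no none = F , record
    { within = F⊆G ; forest = forest
    ; connected = λ u v → label-walk (all-same u v) }
    , (λ _ _ e → e) , λ Q → m≤m+n _ _
    where
    open Components C
    all-same : ∀ u v → label u ≡ label v
    all-same u v with label u ≟ label v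
    ... | yes eq = eq
    ... | no ¬eq = contradiction (u , v , ¬eq) none
  ... | yes (u , v , differ) = merge N few
    where
    open Components C
    crossing = walk-crossing label (connected u v) differ
    x = proj₁ crossing
    y = proj₁ (proj₂ crossing)
    xy = proj₁ (proj₂ (proj₂ crossing))
    lx≢ly = proj₂ (proj₂ (proj₂ crossing))
    x≢y : x ≢ y
    x≢y x≡y = lx≢ly (cong label x≡y)
    ¬walk : ¬ Walk F x y
    ¬walk p = lx≢ly (walk-closed (λ v → label x ≡ label v) (λ e eq → trans eq (label-adj e)) p refl)
    ¬xy : ¬ Adj F x y
    ¬xy e = ¬walk (walk-edge e)
    F′ = addEdge F x y x≢y
    F⊆F′ : Subgraph F F′
    F⊆F′ u v = add-old {F = F} x≢y
    F′⊆G : Subgraph F′ G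
    F′⊆G u v e with add-view {F = F} x≢y e
    ... | inj₁ f = F⊆G u v f
    ... | inj₂ (inj₁ (refl , refl)) = xy
    ... | inj₂ (inj₂ (refl , refl)) = adj-sym G xy
    label′ : V → V
    label′ v = if does (label v ≟ label x) then label y else label v
    label′-y : label′ y ≡ label y
    label′-y rewrite dec-false (label y ≟ label x) (lx≢ly ∘ ≡.sym) = refl
    label′-x : label′ x ≡ label y
    label′-x rewrite dec-true (label x ≟ label x) refl = refl
    x→y : Walk F′ x y
    x→y = walk-edge (add-new {F = F} x≢y)
    label′-walk : ∀ {u v} → label′ u ≡ label′ v → Walk F′ u v
    label′-walk {u} {v} eq with label u ≟ label x | label v ≟ label x
    ... | yes p | yes q = walk-map F⊆F′ (label-walk (trans p (≡.sym q)))
    ... | no _ | no _ = walk-map F⊆F′ (label-walk eq)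
    ... | yes p | no _ = walk-trans (walk-map F⊆F′ (label-walk p)) (walk-trans x→y (walk-map F⊆F′ (label-walk eq)))
    ... | no _ | yes q = walk-sym (walk-trans (walk-map F⊆F′ (label-walk q))
        (walk-trans x→y (walk-map F⊆F′ (label-walk (≡.sym eq)))))
    C′ : Components F′
    C′ = record
      { label = label′
      ; label-adj = λ {u} {v} e → adjacent (add-view {F = F} x≢y e)
      ; label-walk = label′-walk
      }
      where
      adjacent : ∀ {u v} → Adj F u v ⊎ SameEdge x y u v → label′ u ≡ label′ v
      adjacent (inj₁ e) = cong (λ l → if does (l ≟ label x) then label y else l) (label-adj e)
      adjacent (inj₂ (inj₁ (refl , refl))) = trans label′-x (≡.sym label′-y)
      adjacent (inj₂ (inj₂ (refl , refl))) = trans label′-y (≡.sym label′-x)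
    rep′? : Decidable (λ r → Rep r × r ≢ label x)
    rep′? r = rep? r ×-dec ¬? (r ≟ label x)
    rep′ : ∀ v → Rep (label′ v) × label′ v ≢ label x
    rep′ v with label v ≟ label x
    ... | yes _ = rep y , lx≢ly ∘ ≡.sym
    ... | no lv≢lx = rep v , lv≢lx
    fewer : count rep? ≡ suc (count rep′?)
    fewer = count-insert rep′? rep? (label x) (λ (_ , ne) → ne refl) (rep x) (λ _ → proj₁) (λ _ r ne → r , ne)
    merge : ∀ N → count rep? ≤ suc N → JoinedWithin k G F N
    -- With a single admissible label, retiring that of x would leave none, yet the label of y is
    -- still admissible.
    merge zero few = contradiction (s≤s⁻¹ (≤-trans (≤-reflexive (≡.sym fewer)) few))
      (<⇒≱ (count-≥1 rep′? (label′ y) (rep′ y)))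
    merge (suc N) few =
      let T , tree , F′⊆T , short = join-components k connected N F′⊆G (forest-add {F = F} x≢y forest ¬walk) C′ rep′? rep′
                                      (s≤s⁻¹ (≤-trans (≤-reflexive (≡.sym fewer)) few))
      in T , tree , (λ u v e → F′⊆T u v (F⊆F′ u v e)) , λ Q →
         ≤-trans (short Q) (≤-trans (+-monoˡ-≤ (N * (2 * (k ∸ 1))) (shortage-add k Q F x≢y ¬xy))
             (≤-reflexive (+-assoc (shortage k Q F) _ _)))

-- Moving an edge towards a deficient vertex

module _ {n : ℕ} where
  private V = Fin n

  module _ {T : Graph n} (forest : Forest T) where

    side : ∀ {z c w} → Walk T w c → Walk (T ∖[ z , c ]) w c ⊎ Walk (T ∖[ z , c ]) w z
    side {z} {c} p = [ inj₁ , [ inj₂ , inj₁ ]′ ]′ (walk-split z c p)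

    not-both-sides : ∀ {z c w} → Adj T z c → Walk (T ∖[ z , c ]) w z → ¬ Walk (T ∖[ z , c ]) w c
    not-both-sides e p q = forest e (walk-trans (walk-sym p) q)

    -- Deleting either of the edges z₁c and z₂c leaves w in a component with c for at least one of the two.
    not-both-far : ∀ {z₁ z₂ c w} → z₁ ≢ z₂ → Adj T z₁ c → Adj T z₂ c →
      Walk (T ∖[ z₁ , c ]) w z₁ → ¬ Walk (T ∖[ z₂ , c ]) w z₂
    not-both-far {z₁} {z₂} {c} {w} z₁≢z₂ e₁ e₂ p₁ p₂ = cases (walk-split z₂ c p₁)
      where
      T₁ = T ∖[ z₁ , c ]
      T₂ = T ∖[ z₂ , c ]
      T₁₂ = T₁ ∖[ z₂ , c ]
      z₁≢c = adj-irrefl T e₁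
      z₂≢c = adj-irrefl T e₂
      e₂′ : Adj T₁ z₂ c
      e₂′ = remove-intro {F = T} e₂ λ { (inj₁ (z₂≡z₁ , _)) → z₁≢z₂ (≡.sym z₂≡z₁) ; (inj₂ (z₂≡c , _)) → z₂≢c z₂≡c }
      e₁′ : Adj T₂ z₁ c
      e₁′ = remove-intro {F = T} e₁ λ { (inj₁ (z₁≡z₂ , _)) → z₁≢z₂ z₁≡z₂ ; (inj₂ (z₁≡c , _)) → z₁≢c z₁≡c }
      to₁ : ∀ {u v} → Walk T₁₂ u v → Walk T₁ u v
      to₁ = walk-map (remove-⊆ {F = T₁})
      to₂ : ∀ {u v} → Walk T₁₂ u v → Walk T₂ u v
      to₂ = walk-map (remove-mono {F = T₁} {H = T} (remove-⊆ {F = T}))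
      -- The walk to `z₁` either avoids z₂c and continues over z₁c to c, or it reaches `z₂` or c
      -- with neither edge. Each case puts w on c's side of one of the two deleted edges.
      cases : Walk T₁₂ w z₁ ⊎ (Walk T₁₂ w z₂ ⊎ Walk T₁₂ w c) → ⊥
      cases (inj₁ q) = not-both-sides e₂ p₂ (walk-trans (to₂ q) (walk-edge e₁′))
      cases (inj₂ (inj₁ q)) = not-both-sides e₁ p₁ (walk-trans (to₁ q) (walk-edge e₂′))
      cases (inj₂ (inj₂ q)) = not-both-sides e₁ p₁ (to₁ q)

  -- `improves` is an equality, so each move lowers the total deficit by exactly one; this keeps all
  -- remaining budgets in step with the number of moves.
  record Moved (k : ℕ) (G T : Graph n) (z c w : V) : Set where
    field
      tree       : Graph n
      spanning   : SpanningTree G tree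
      keeps      : ∀ {u v} → Adj T u v → ¬ SameEdge z c u v → Adj tree u v
      improves   : ∀ v → deficit k (deg T v) ≡ deficit k (deg tree v) + bit (does (v ≟ w))
      deg-loss   : ∀ v → deg T v ≤ suc (deg tree v)

  -- z exchanges one neighbour for another and keeps its degree, w gains one, and c loses one but
  -- starts with at least k + 2. Hence only the deficit of w changes. No cycle arises because w
  -- stays on c's side, away from z.
  move : ∀ {k} {G T : Graph n} {z c w} → SpanningTree G T → Adj G z w → Adj T z c → Walk (T ∖[ z , c ]) w c → w ≢ c →
    1 ≤ deficit k (deg T w) → suc k < deg T c → Moved k G T z c w
  move {k} {G} {T} {z} {c} {w} tree zw zc w→c w≢c needy rich = record
    { tree = T′
    ; spanning = record { within = T′⊆G ; forest = forest-add {F = T₁} z≢w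
        (forest-⊆ {F = T₁} {H = T} (remove-⊆ {F = T} {z} {c}) forest) ¬walk
                        ; connected = λ u v → walk-bind reroute (connected u v) }
    ; keeps = keeps
    ; improves = improves
    ; deg-loss = deg-loss
    }
    where
    open SpanningTree tree
    T₁ = T ∖[ z , c ]
    z≢w = adj-irrefl G zw
    z≢c = adj-irrefl T zc
    ¬walk : ¬ Walk T₁ z w
    ¬walk p = forest zc (walk-trans p w→c)
    ¬zw : ¬ Adj T₁ z w
    ¬zw e = ¬walk (walk-edge e)
    T′ = addEdge T₁ z w z≢w
    keeps : ∀ {u v} → Adj T u v → ¬ SameEdge z c u v → Adj T′ u v
    keeps e ¬s = add-old {F = T₁} z≢w (remove-intro {F = T} e ¬s)
    T′⊆G : Subgraph T′ G
    T′⊆G u v e with add-view {F = T₁} z≢w e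
    ... | inj₁ f = within u v (remove-⊆ {F = T} u v f)
    ... | inj₂ (inj₁ (refl , refl)) = zw
    ... | inj₂ (inj₂ (refl , refl)) = adj-sym G zw
    z→c : Walk T′ z c
    z→c = step (add-new {F = T₁} z≢w) (walk-map (λ u v → add-old {F = T₁} z≢w) w→c)
    reroute : ∀ {u v} → Adj T u v → Walk T′ u v
    reroute {u} {v} e with sameEdge? z c u v
    ... | yes (inj₁ (refl , refl)) = z→c
    ... | yes (inj₂ (refl , refl)) = walk-sym z→c
    ... | no ¬s = walk-edge (keeps e ¬s)
    deg-z : deg T z ≡ deg T′ z
    deg-z = trans (deg-remove-left {F = T} zc) (≡.sym (deg-add-left {F = T₁} z≢w ¬zw))
    deg-w : suc (deg T w) ≡ deg T′ w
    deg-w = trans (cong suc (deg-remove-other {F = T} zc (z≢w ∘ ≡.sym) w≢c)) (≡.sym (deg-add-right {F = T₁} z≢w ¬zw))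
    deg-c : deg T c ≡ suc (deg T′ c)
    deg-c = trans (deg-remove-right {F = T} zc)
        (cong suc (≡.sym (deg-add-other {F = T₁} z≢w ¬zw (z≢c ∘ ≡.sym) (w≢c ∘ ≡.sym))))
    deg-other : ∀ {v} → v ≢ z → v ≢ c → v ≢ w → deg T v ≡ deg T′ v
    deg-other v≢z v≢c v≢w = trans (deg-remove-other {F = T} zc v≢z v≢c)
        (≡.sym (deg-add-other {F = T₁} z≢w ¬zw v≢z v≢w))
    bit-no : ∀ {v} → v ≢ w → bit (does (v ≟ w)) ≡ 0
    bit-no {v} v≢w = cong bit (dec-false (v ≟ w) v≢w)
    unchanged : ∀ {v} → v ≢ w → deficit k (deg T v) ≡ deficit k (deg T′ v) → deficit k (deg T v) ≡ deficit k
        (deg T′ v) + bit (does (v ≟ w))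
    unchanged {v} v≢w eq = trans eq
        (trans (≡.sym (+-identityʳ _)) (cong (deficit k (deg T′ v) +_) (≡.sym (bit-no v≢w))))
    improves : ∀ v → deficit k (deg T v) ≡ deficit k (deg T′ v) + bit (does (v ≟ w))
    improves v = by-cases (v ≟ w) (v ≟ z) (v ≟ c)
      where
      by-cases : Dec (v ≡ w) → Dec (v ≡ z) → Dec (v ≡ c) → deficit k (deg T v) ≡ deficit k (deg T′ v) + bit
          (does (v ≟ w))
      by-cases (yes refl) _ _ = begin
        deficit k (deg T w)                          ≡⟨ proj₁ (deficit-suc {d = deg T w} needy) ⟩
        suc (deficit k (suc (deg T w)))              ≡⟨ cong (suc ∘ deficit k) deg-w ⟩
        suc (deficit k (deg T′ w))                   ≡⟨ +-comm 1 _ ⟩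
        deficit k (deg T′ w) + 1
            ≡⟨ cong (λ b → deficit k (deg T′ w) + bit b) (≡.sym (dec-true (w ≟ w) refl)) ⟩
        deficit k (deg T′ w) + bit (does (w ≟ w))    ∎
        where open ≡.≡-Reasoning
      by-cases (no v≢w) (yes refl) _ = unchanged v≢w (cong (deficit k) deg-z)
      by-cases (no v≢w) (no _) (yes refl) = unchanged v≢w
        (trans (deficit-large {d = deg T c} (≤-trans (n≤1+n _) rich))
               (≡.sym (deficit-large {d = deg T′ c} (s≤s⁻¹ (≤-trans rich (≤-reflexive deg-c))))))
      by-cases (no v≢w) (no v≢z) (no v≢c) = unchanged v≢w (cong (deficit k) (deg-other v≢z v≢c v≢w))
    deg-loss : ∀ v → deg T v ≤ suc (deg T′ v)
    deg-loss v = by-cases (v ≟ w) (v ≟ z) (v ≟ c)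
      where
      by-cases : Dec (v ≡ w) → Dec (v ≡ z) → Dec (v ≡ c) → deg T v ≤ suc (deg T′ v)
      by-cases (yes refl) _ _ = ≤-trans (n≤1+n _) (≤-trans (≤-reflexive deg-w) (n≤1+n _))
      by-cases (no _) (yes refl) _ = ≤-trans (≤-reflexive deg-z) (n≤1+n _)
      by-cases (no _) (no _) (yes refl) = ≤-reflexive deg-c
      by-cases (no v≢w) (no v≢z) (no v≢c) = ≤-trans (≤-reflexive (deg-other v≢z v≢c v≢w)) (n≤1+n _)

  -- Removing all deficits

  module Stealing (k : ℕ) (G : Graph n) (home : V → V) {Centre : V → Set} (centre? : Decidable Centre)
    (first : V → Bool) where

    reachable? : {Act : V → Set} → Decidable Act → ∀ w → Decidable (λ z → Adj G w z × Act z)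
    reachable? act? w z = neighbour? G w z ×-dec act? z

    early late : Graph n → ℕ
    early T = shortage k first T
    late T = shortage k (not ∘ first) T

    -- The invariant of the edge moves; `Act` holds the vertices still hanging from their original
    -- parent. A move uses up one unit of deficit, one active vertex and at most one edge of a
    -- centre, so each inequality carries the remaining deficit as slack. `plenty-early` reserves
    -- active vertices for early deficits alone and is demanded only while one remains.
    record Stock (T : Graph n) : Set₁ where
      field
        spanning   : SpanningTree G T
        {Act}      : V → Set
        act?       : Decidable Act
        at-home    : ∀ z → Act z → Adj T z (home z)
        home-centre : ∀ z → Act z → Centre (home z)
        home-twice : ∀ z → Act z → home (home z) ≢ z
        rich       : ∀ c → Centre c → suc k + (early T + late T) ≤ deg T c
        plenty-early : ∀ w → Data.Bool.T (first w) → 1 ≤ early T → count centre? + early T ≤ count (reachable? act? w)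
        plenty-late  : ∀ w → Data.Bool.T (not (first w)) → count centre? + (early T + late T) ≤ count
            (reachable? act? w)

    steal : ∀ {T} (S : Stock T) w → 1 ≤ deficit k (deg T w) → 1 ≤ early T + late T →
      count centre? < count (reachable? (Stock.act? S) w) →
      ∃ λ z → Stock.Act S z × Moved k G T z (home z) w
    steal {T} S w needy pos many = choose
        (count-pigeonhole (reachable? act? w) centre? home (λ z (_ , az) → home-centre z az) many)
      where
      open Stock S
      open SpanningTree spanning
      ¬centre-w : ¬ Centre w
      ¬centre-w cw = contradiction needy
          (<⇒≱ (s≤s (≤-reflexive (deficit-large {d = deg T w} (≤-trans (m≤m+n (suc k) _) (rich w cw))))))
      go : ∀ z → Adj G w z → Act z → Walk (T ∖[ z , home z ]) w (home z) → ∃ λ z → Act z × Moved k G T z (home z) w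
      go z wz az p = z , az , move spanning (adj-sym G wz) (at-home z az) p
        (λ w≡c → ¬centre-w (subst Centre (≡.sym w≡c) (home-centre z az))) needy
        (≤-trans (≤-reflexive (≡.sym (+-comm (suc k) 1)))
            (≤-trans (+-monoʳ-≤ (suc k) pos) (rich (home z) (home-centre z az))))
      choose : (∃₂ λ z₁ z₂ → z₁ ≢ z₂ × (Adj G w z₁ × Act z₁) × (Adj G w z₂ × Act z₂) × home z₁ ≡ home z₂) →
        ∃ λ z → Act z × Moved k G T z (home z) w
      choose (z₁ , z₂ , z₁≢z₂ , (wz₁ , a₁) , (wz₂ , a₂) , same)
        with side forest {z = z₁} (connected w (home z₁)) | side forest {z = z₂} (connected w (home z₂))
      ... | inj₁ p | _ = go z₁ wz₁ a₁ p
      ... | inj₂ _ | inj₁ p = go z₂ wz₂ a₂ p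
      ... | inj₂ p | inj₂ q = contradiction (subst (λ c → Walk (T ∖[ z₂ , c ]) w z₂) (≡.sym same) q)
        (not-both-far {T = T} forest z₁≢z₂ (at-home z₁ a₁) (subst (Adj T z₂) (≡.sym same) (at-home z₂ a₂)) p)

    shortage-moved : ∀ {T T′ w} (Q : V → Bool) →
        (∀ v → deficit k (deg T v) ≡ deficit k (deg T′ v) + bit (does (v ≟ w))) →
      shortage k Q T ≡ bit (Q w) + shortage k Q T′
    shortage-moved {T} {T′} {w} Q improves = by-cases (Q w) refl
      where
      term : Graph n → V → ℕ
      term H v = if Q v then deficit k (deg H v) else 0
      by-cases : ∀ b → Q w ≡ b → shortage k Q T ≡ bit b + shortage k Q T′
      by-cases true Qw = sum-bump {f = term T} {g = term T′} w pointwise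
        where
        pointwise : ∀ v → term T v ≡ term T′ v + bit (does (v ≟ w))
        pointwise v with Q v in Qv
        ... | true = improves v
        ... | false = cong bit (≡.sym (dec-false (v ≟ w) λ { refl → contradiction (trans (≡.sym Qv) Qw) λ () }))
      by-cases false Qw = sum-cong-≗ {n} {term T} {term T′} pointwise
        where
        pointwise : ∀ v → term T v ≡ term T′ v
        pointwise v with Q v in Qv
        ... | false = refl
        ... | true = trans (improves v) (trans (cong (λ b → deficit k (deg T′ v) + bit b)
              (dec-false (v ≟ w) λ { refl → contradiction (trans (≡.sym Qv) Qw) λ () })) (+-identityʳ _))

    -- Each side of the supply inequalities drops by at most one, the demand by exactly one.
    -- `plenty-early` survives because either the served vertex was early or no early deficit is
    -- left.
    restock : ∀ {T} (S : Stock T) {z w} → Stock.Act S z → (M : Moved k G T z (home z) w) →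
      early T + late T ≡ suc (early (Moved.tree M) + late (Moved.tree M)) →
      early (Moved.tree M) ≤ early T →
      (1 ≤ early (Moved.tree M) → early T ≡ suc (early (Moved.tree M))) → Stock (Moved.tree M)
    restock {T} S {z} {w} az M total≡ early≤ early≡ = record
      { spanning = Moved.spanning M
      ; act? = act′?
      -- Edges are undirected: losing the edge of z could also harm z′ = home z, but only if home z′
      -- were z, which `home-twice` excludes.
      ; at-home = λ z′ (az′ , z′≢z) → Moved.keeps M (at-home z′ az′)
          λ { (inj₁ (z′≡z , _)) → z′≢z z′≡z ; (inj₂ (z′≡hz , hz′≡z)) → home-twice z az
              (trans (cong home (≡.sym z′≡hz)) hz′≡z) }
      ; home-centre = λ z′ (az′ , _) → home-centre z′ az′
      ; home-twice = λ z′ (az′ , _) → home-twice z′ az′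
      ; rich = λ c cc → s≤s⁻¹ (≤-trans
          (≤-reflexive (trans (≡.sym (+-suc (suc k) _)) (cong (suc k +_) (≡.sym total≡))))
                               (≤-trans (rich c cc) (Moved.deg-loss M c)))
      ; plenty-early = λ v fv pos → s≤s⁻¹
          (≤-trans (≤-reflexive (trans (≡.sym (+-suc (count centre?) _))
              (cong (count centre? +_) (≡.sym (early≡ pos)))))
                               (≤-trans (plenty-early v fv (≤-trans pos early≤)) (loss v)))
      ; plenty-late = λ v fv → s≤s⁻¹ (≤-trans
          (≤-reflexive (trans (≡.sym (+-suc (count centre?) _)) (cong (count centre? +_) (≡.sym total≡))))
                               (≤-trans (plenty-late v fv) (loss v)))
      }
      where
      open Stock S
      act′? : Decidable (λ z′ → Act z′ × z′ ≢ z)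
      act′? z′ = act? z′ ×-dec ¬? (z′ ≟ z)
      loss : ∀ v → count (reachable? act? v) ≤ suc (count (reachable? act′? v))
      loss v = ≤-trans (count-cover (reachable? act′? v) (_≟ z) (reachable? act? v) cover)
        (≤-reflexive (trans (cong (count (reachable? act′? v) +_) (count-point z)) (+-comm _ 1)))
        where
        cover : ∀ i → Adj G v i × Act i → (Adj G v i × Act i × i ≢ z) ⊎ i ≡ z
        cover i (e , a) with i ≟ z
        ... | yes i≡z = inj₂ i≡z
        ... | no i≢z = inj₁ (e , a , i≢z)

    Perfect : Set
    Perfect = ∃ λ T → SpanningTree G T × (∀ v → deficit k (deg T v) ≡ 0)

    needy? : ∀ (Q : V → Bool) T v → Dec (Data.Bool.T (Q v) × 1 ≤ deficit k (deg T v))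
    needy? Q T v = T? (Q v) ×-dec (1 ≤? deficit k (deg T v))

    shortage-pos : ∀ (Q : V → Bool) T v → Data.Bool.T (Q v) → 1 ≤ deficit k (deg T v) → 1 ≤ shortage k Q T
    shortage-pos Q T v Qv pos = ≤-trans (≤-trans pos (≤-reflexive (if-true (Q v) Qv)))
        (term≤sum (λ v → if Q v then deficit k (deg T v) else 0) v)
      where
      if-true : ∀ b → Data.Bool.T b → deficit k (deg T v) ≡ (if b then deficit k (deg T v) else 0)
      if-true true _ = refl

    shortage-none : ∀ (Q : V → Bool) T → ¬ (∃ λ v → Data.Bool.T (Q v) × 1 ≤ deficit k (deg T v)) → shortage k Q T ≡ 0
    shortage-none Q T none = ≤-antisym (≤-trans (sum-≤ 0 vanish) (≤-reflexive (*-zeroʳ n))) z≤n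
      where
      vanish : ∀ v → (if Q v then deficit k (deg T v) else 0) ≤ 0
      vanish v with Q v in Qv
      ... | false = z≤n
      ... | true = s≤s⁻¹ (≰⇒> λ pos → none (v , subst Data.Bool.T (≡.sym Qv) _ , pos))

    -- The order matters: the supply of an early vertex is guaranteed only against early demand,
    -- while that of a late vertex covers everything, including what the early moves consume.
    steal-all : ∀ N {T} → Stock T → early T + late T ≡ N → Perfect
    steal-all N {T} S total with any? (needy? first T) | any? (needy? (not ∘ first) T)
    ... | yes (w , fw , pos) | _ = continue N total
      where
      open Stock S
      early-pos = shortage-pos first T w fw pos
      stolen = steal S w pos (≤-trans early-pos (m≤m+n _ _))
                 (≤-trans (≤-trans (≤-reflexive (≡.sym (+-comm (count centre?) 1)))
                     (+-monoʳ-≤ (count centre?) early-pos)) (plenty-early w fw early-pos))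
      z = proj₁ stolen
      az = proj₁ (proj₂ stolen)
      M = proj₂ (proj₂ stolen)
      open Moved M using (tree; improves)
      early≡ : early T ≡ suc (early tree)
      early≡ = trans (shortage-moved {T} {tree} first improves) (cong (λ b → bit b + early tree) (T⇒true fw))
        where
        T⇒true : ∀ {b} → Data.Bool.T b → b ≡ true
        T⇒true {true} _ = refl
      late≡ : late T ≡ late tree
      late≡ = trans (shortage-moved {T} {tree} (not ∘ first) improves) (cong (λ b → bit b + late tree) (T⇒false fw))
        where
        T⇒false : ∀ {b} → Data.Bool.T b → not b ≡ false
        T⇒false {true} _ = refl
      total≡ : early T + late T ≡ suc (early tree + late tree)
      total≡ = cong₂ _+_ early≡ late≡
      continue : ∀ N → early T + late T ≡ N → Perfect
      continue zero total = contradiction (trans (≡.sym total≡) total) λ ()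
      continue (suc N) total = steal-all N
        (restock S az M total≡ (≤-trans (n≤1+n _) (≤-reflexive (≡.sym early≡))) (λ _ → early≡))
        (suc-injective (trans (≡.sym total≡) total))
    ... | no none | yes (w , fw , pos) = continue N total
      where
      open Stock S
      early-zero = shortage-none first T none
      total-pos = ≤-trans (shortage-pos (not ∘ first) T w fw pos) (m≤n+m _ (early T))
      stolen = steal S w pos total-pos
                 (≤-trans (≤-trans (≤-reflexive (≡.sym (+-comm (count centre?) 1)))
                     (+-monoʳ-≤ (count centre?) total-pos)) (plenty-late w fw))
      z = proj₁ stolen
      az = proj₁ (proj₂ stolen)
      M = proj₂ (proj₂ stolen)
      open Moved M using (tree; improves)
      early≡ : early T ≡ early tree
      early≡ = trans (shortage-moved {T} {tree} first improves) (cong (λ b → bit b + early tree) (T⇒false fw))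
        where
        T⇒false : ∀ {b} → Data.Bool.T (not b) → b ≡ false
        T⇒false {false} _ = refl
      late≡ : late T ≡ suc (late tree)
      late≡ = trans (shortage-moved {T} {tree} (not ∘ first) improves) (cong (λ b → bit b + late tree) (T⇒true fw))
        where
        T⇒true : ∀ {b} → Data.Bool.T b → b ≡ true
        T⇒true {true} _ = refl
      total≡ : early T + late T ≡ suc (early tree + late tree)
      total≡ = trans (cong₂ _+_ early≡ late≡) (+-suc (early tree) (late tree))
      tree-early-zero : early tree ≡ 0
      tree-early-zero = trans (≡.sym early≡) early-zero
      continue : ∀ N → early T + late T ≡ N → Perfect
      continue zero total = contradiction (trans (≡.sym total≡) total) λ ()
      continue (suc N) total = steal-all N
        (restock S az M total≡ (≤-reflexive (≡.sym early≡))
            (λ pos → contradiction (≤-reflexive tree-early-zero) (<⇒≱ pos)))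
        (suc-injective (trans (≡.sym total≡) total))
    ... | no none | no none′ = T , Stock.spanning S , fine
      where
      fine : ∀ v → deficit k (deg T v) ≡ 0
      fine v with deficit k (deg T v) in eq | first v in fv
      ... | zero | _ = refl
      ... | suc _ | true = contradiction
          (v , subst Data.Bool.T (≡.sym fv) _ , ≤-trans (s≤s z≤n) (≤-reflexive (≡.sym eq))) none
      ... | suc _ | false = contradiction
          (v , subst (Data.Bool.T ∘ not) (≡.sym fv) _ , ≤-trans (s≤s z≤n) (≤-reflexive (≡.sym eq))) none′

-- Rooted forests

-- Roots are the fixed points of `par`. The rank is the depth; it rules out cycles of parents and
-- tells how many iterations of `par` reach the root.
record Rooted (n : ℕ) : Set where
  field
    par        : Fin n → Fin n
    rank       : Fin n → ℕ
    root-rank  : ∀ {v} → par v ≡ v → rank v ≡ 0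
    child-rank : ∀ {v} → par v ≢ v → rank v ≡ suc (rank (par v))

module _ {n : ℕ} where
  private V = Fin n

  module RootedForest (R : Rooted n) where
    open Rooted R

    Child : V → V → Set
    Child v u = u ≢ v × par u ≡ v

    child? : ∀ v → Decidable (Child v)
    child? v u = ¬? (u ≟ v) ×-dec (par u ≟ v)

    children : V → ℕ
    children v = count (child? v)

    Link : V → V → Set
    Link u v = u ≢ v × (par u ≡ v ⊎ par v ≡ u)

    link? : ∀ u v → Dec (Link u v)
    link? u v = ¬? (u ≟ v) ×-dec ((par u ≟ v) ⊎-dec (par v ≟ u))

    graph : Graph n
    graph = mkGraph link? (λ (ne , e) → ne ∘ ≡.sym , [ inj₂ , inj₁ ]′ e) (λ v (ne , _) → ne refl)

    link : ∀ {u v} → Adj graph u v → Link u v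
    link {u} {v} = from-does (link? u v)

    unlink : ∀ {u v} → Link u v → Adj graph u v
    unlink {u} {v} = to-does (link? u v)

    par-par : ∀ {v} → par v ≢ v → par (par v) ≢ v
    par-par {v} pv≢v ppv≡v = <⇒≱ (n<1+n (rank (par v))) (≤-trans (n≤1+n _) (≤-reflexive (begin
        suc (suc (rank (par v)))    ≡⟨ cong suc (≡.sym (child-rank pv≢v)) ⟩
        suc (rank v)                ≡⟨ cong (suc ∘ rank) (≡.sym ppv≡v) ⟩
        suc (rank (par (par v)))    ≡⟨ ≡.sym (child-rank (λ eq → pv≢v (trans (≡.sym eq) ppv≡v))) ⟩
        rank (par v)                ∎)))
      where open ≡.≡-Reasoning

    deg-root : ∀ {v} → par v ≡ v → deg graph v ≡ children v
    deg-root {v} root = trans (deg≡count graph v) (count-cong (neighbour? graph v) (child? v)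
      (λ u e → case-link (link e)) (λ u (ne , pu≡v) → unlink (ne ∘ ≡.sym , inj₂ pu≡v)))
      where
      case-link : ∀ {u} → Link v u → Child v u
      case-link (ne , inj₁ pv≡u) = contradiction (trans (≡.sym root) pv≡u) ne
      case-link (ne , inj₂ pu≡v) = ne ∘ ≡.sym , pu≡v

    deg-child : ∀ {v} → par v ≢ v → deg graph v ≡ suc (children v)
    deg-child {v} nonroot = trans (deg≡count graph v) (count-insert (child? v) (neighbour? graph v) (par v)
      (λ (_ , ppv≡v) → par-par nonroot ppv≡v)
      (unlink (nonroot ∘ ≡.sym , inj₁ refl))
      (λ u (ne , pu≡v) → unlink (ne ∘ ≡.sym , inj₂ pu≡v))
      (λ u e u≢pv → case-link (link e) u≢pv))
      where
      case-link : ∀ {u} → Link v u → u ≢ par v → Child v u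
      case-link (ne , inj₁ pv≡u) u≢pv = contradiction (≡.sym pv≡u) u≢pv
      case-link (ne , inj₂ pu≡v) _ = ne ∘ ≡.sym , pu≡v

    ancestor : ℕ → V → V
    ancestor zero v = v
    ancestor (suc j) v = ancestor j (par v)

    top : V → V
    top v = ancestor (rank v) v

    top-par : ∀ {v} → par v ≢ v → top v ≡ top (par v)
    top-par {v} nonroot rewrite child-rank nonroot = refl

    top-link : ∀ {u v} → Link u v → top u ≡ top v
    top-link (ne , inj₁ refl) = top-par (ne ∘ ≡.sym)
    top-link (ne , inj₂ refl) = ≡.sym (top-par ne)

    rank-ancestor : ∀ j v → rank (ancestor j v) ≤ rank v
    rank-ancestor zero v = ≤-refl
    rank-ancestor (suc j) v = ≤-trans (rank-ancestor j (par v)) (by-cases (par v ≟ v))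
      where
      by-cases : Dec (par v ≡ v) → rank (par v) ≤ rank v
      by-cases (yes root) = ≤-reflexive (cong rank root)
      by-cases (no nonroot) = ≤-trans (n≤1+n _) (≤-reflexive (≡.sym (child-rank nonroot)))

    rank-top : ∀ r v → rank v ≡ r → Walk graph v (top v) × par (top v) ≡ top v
    rank-top r v eq with par v ≟ v
    rank-top r v eq | yes root rewrite root-rank root = here , root
    rank-top zero v eq | no nonroot = contradiction (trans (≡.sym eq) (child-rank nonroot)) λ ()
    rank-top (suc r) v eq | no nonroot
      with rank-top r (par v) (suc-injective (trans (≡.sym (child-rank nonroot)) eq))
    ... | p , root rewrite top-par nonroot = step (unlink (nonroot ∘ ≡.sym , inj₁ refl)) p , root

    walk-top : ∀ v → Walk graph v (top v)
    walk-top v = proj₁ (rank-top (rank v) v refl)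

    top-root : ∀ v → par (top v) ≡ top v
    top-root v = proj₂ (rank-top (rank v) v refl)

    components : Components graph
    components = record
      { label = top
      ; label-adj = top-link ∘ link
      ; label-walk = λ {u} {v} eq → walk-trans (walk-top u)
          (subst (λ t → Walk graph t v) (≡.sym eq) (walk-sym (walk-top v)))
      }

    -- Without the edge from a to its parent, the descendants of a are closed under adjacency.
    up-bridge : ∀ {a} → par a ≢ a → ¬ Walk (graph ∖[ a , par a ]) a (par a)
    up-bridge {a} nonroot p = conclude (walk-closed (λ v → ∃ λ j → ancestor j v ≡ a) closed p (0 , refl))
      where
      conclude : ¬ (∃ λ j → ancestor j (par a) ≡ a)
      conclude (j , eq) = <⇒≱ (n<1+n (rank (par a)))
        (≤-trans (≤-reflexive (trans (≡.sym (child-rank nonroot)) (cong rank (≡.sym eq)))) (rank-ancestor j (par a)))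
      closed : ∀ {u v} → Adj (graph ∖[ a , par a ]) u v → (∃ λ j → ancestor j u ≡ a) → ∃ λ j → ancestor j v ≡ a
      closed {u} {v} e desc = next desc (link {u} {v} (proj₁ (remove-view {F = graph} {u = u} {v} e)))
        where
        next : (∃ λ j → ancestor j u ≡ a) → Link u v → ∃ λ j → ancestor j v ≡ a
        next (j , eq) (_ , inj₂ refl) = suc j , eq
        next (suc j , eq) (_ , inj₁ refl) = j , eq
        next (zero , eq) (_ , inj₁ refl) =
          contradiction (inj₁ (eq , cong par eq)) (proj₂ (remove-view {F = graph} {u = u} {v} e))

    forest : Forest graph
    forest {a} {b} e p with link {a} {b} e
    ... | ne , inj₁ refl = up-bridge (ne ∘ ≡.sym) p
    ... | ne , inj₂ refl = up-bridge ne (walk-sym (walk-map flip p))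
      where
      flip : Subgraph (graph ∖[ par b , b ]) (graph ∖[ b , par b ])
      flip u v e = let g , ¬s = remove-view {F = graph} {u = u} {v} e in
        remove-intro {F = graph} {u = u} {v} g λ { (inj₁ s) → ¬s (inj₂ s) ; (inj₂ s) → ¬s (inj₁ s) }

-- Growing a rooted forest

-- Both ends of every parent edge are covered, so an uncovered vertex is an isolated root. It can be
-- given a parent without breaking an edge or moving a subtree.
record Growth {n : ℕ} (G : Graph n) : Set₁ where
  field
    rooted     : Rooted n
  open Rooted rooted public
  open RootedForest rooted public using (Child; child?; children)
  field
    {Covered}  : Fin n → Set
    covered?   : Decidable Covered
    par-adj    : ∀ {v} → par v ≢ v → Adj G v (par v)
    child-covered  : ∀ {v} → par v ≢ v → Covered v
    parent-covered : ∀ {v} → par v ≢ v → Covered (par v)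

  Fresh : Fin n → Fin n → Set
  Fresh y u = Adj G y u × ¬ Covered u

  fresh? : ∀ y → Decidable (Fresh y)
  fresh? y u = neighbour? G y u ×-dec ¬? (covered? u)

module _ {n : ℕ} {G : Graph n} where
  private V = Fin n

  module Adopt (S : Growth G) (y : V) where
    open Growth S

    override : {A : Set} → (V → A) → A → V → A
    override f a u = if does (fresh? y u) then a else f u

    override-in : ∀ {A : Set} (f : V → A) a {u} → Fresh y u → override f a u ≡ a
    override-in f a {u} fresh = cong (λ b → if b then a else f u) (dec-true (fresh? y u) fresh)

    override-out : ∀ {A : Set} (f : V → A) a {u} → ¬ Fresh y u → override f a u ≡ f u
    override-out f a {u} ¬fresh = cong (λ b → if b then a else f u) (dec-false (fresh? y u) ¬fresh)

    par′ : V → V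
    par′ = override par y

    rank′ : V → ℕ
    rank′ = override rank (suc (rank y))

    y-stale : ¬ Fresh y y
    y-stale (e , _) = adj-irrefl G e refl

    covered-stale : ∀ {u} → Covered u → ¬ Fresh y u
    covered-stale cu (_ , ¬cu) = ¬cu cu

    root-stale : ∀ {v} → par′ v ≡ v → ¬ Fresh y v × par v ≡ v
    root-stale {v} eq = stale , trans (≡.sym (override-out par y stale)) eq
      where
      stale : ¬ Fresh y v
      stale fresh = y-stale (subst (Fresh y) (trans (≡.sym eq) (override-in par y fresh)) fresh)

    ChildView : V → Set
    ChildView v = (Fresh y v × par′ v ≡ y × rank′ v ≡ suc (rank y)) ⊎
                  (¬ Fresh y v × par v ≢ v × par′ v ≡ par v × rank′ v ≡ rank v)

    child-view : ∀ {v} → par′ v ≢ v → ChildView v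
    child-view {v} ne = by-cases (fresh? y v)
      where
      by-cases : Dec (Fresh y v) → ChildView v
      by-cases (yes fresh) = inj₁ (fresh , override-in par y fresh , override-in rank _ fresh)
      by-cases (no stale) = inj₂ (stale , ne ∘ trans
          (override-out par y stale) , override-out par y stale , override-out rank _ stale)

    rooted′ : Rooted n
    rooted′ = record
      { par = par′
      ; rank = rank′
      ; root-rank = λ {v} eq → let stale , root = root-stale eq in trans (override-out rank _ stale) (root-rank root)
      ; child-rank = λ {v} ne → ranks v (child-view ne)
      }
      where
      ranks : ∀ v → ChildView v → rank′ v ≡ suc (rank′ (par′ v))
      ranks v (inj₁ (_ , p≡ , r≡)) = trans r≡ (cong suc (≡.sym (trans (cong rank′ p≡) (override-out rank _ y-stale))))
      -- The parent of an old child is covered, hence not fresh, so its rank has not changed;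
      -- freshly adopted vertices have no descendants to re-rank.
      ranks v (inj₂ (_ , ne , p≡ , r≡)) = trans r≡ (trans (child-rank ne)
        (cong suc (≡.sym (trans (cong rank′ p≡) (override-out rank _ (covered-stale (parent-covered ne)))))))

    Covered′ : V → Set
    Covered′ u = Covered u ⊎ (Fresh y u ⊎ u ≡ y)

    adopt : Growth G
    adopt = record
      { rooted = rooted′
      ; covered? = λ u → covered? u ⊎-dec (fresh? y u ⊎-dec (u ≟ y))
      ; par-adj = λ {v} ne → adjacent v (child-view ne)
      ; child-covered = λ {v} ne → cov v (child-view ne)
      ; parent-covered = λ {v} ne → pcov v (child-view ne)
      }
      where
      adjacent : ∀ v → ChildView v → Adj G v (par′ v)
      adjacent v (inj₁ (fresh , p≡ , _)) = subst (Adj G v) (≡.sym p≡) (adj-sym G (proj₁ fresh))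
      adjacent v (inj₂ (_ , ne , p≡ , _)) = subst (Adj G v) (≡.sym p≡) (par-adj ne)
      cov : ∀ v → ChildView v → Covered′ v
      cov v (inj₁ (fresh , _)) = inj₂ (inj₁ fresh)
      cov v (inj₂ (_ , ne , _)) = inj₁ (child-covered ne)
      pcov : ∀ v → ChildView v → Covered′ (par′ v)
      pcov v (inj₁ (_ , p≡ , _)) = inj₂ (inj₂ p≡)
      pcov v (inj₂ (_ , ne , p≡ , _)) = inj₁ (subst Covered (≡.sym p≡) (parent-covered ne))

    private module S′ = Growth adopt

    par-covered : ∀ {u} → Covered u → par′ u ≡ par u
    par-covered cu = override-out par y (covered-stale cu)

    child-kept : ∀ v u → Child v u → S′.Child v u
    child-kept v u (ne , pu≡v) = ne , trans (par-covered (child-covered λ pu≡u → ne (trans (≡.sym pu≡u) pu≡v))) pu≡v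

    children-mono : ∀ v → children v ≤ S′.children v
    children-mono v = count-mono (child? v) (S′.child? v) (child-kept v)

    children-adopter : count (fresh? y) ≤ S′.children y
    children-adopter = count-mono (fresh? y) (S′.child? y)
      λ u fresh → (λ { refl → y-stale fresh }) , override-in par y fresh

    children-other : ∀ {v} → v ≢ y → S′.children v ≡ children v
    children-other {v} v≢y = count-cong (S′.child? v) (child? v) back (child-kept v)
      where
      back : ∀ u → S′.Child v u → Child v u
      back u (ne , p′u≡v) = ne , trans (≡.sym (override-out par y stale)) p′u≡v
        where
        stale : ¬ Fresh y u
        stale fresh = v≢y (trans (≡.sym p′u≡v) (override-in par y fresh))

  open Adopt public using (adopt)

  fresh-count : (S : Growth G) → V → ℕ
  fresh-count S y = count (Growth.fresh? S y)

  uncovered? : (S : Growth G) → Decidable (λ v → ¬ Growth.Covered S v)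
  uncovered? S v = ¬? (Growth.covered? S v)

  -- An uncovered adopter would start a new tree, so its threshold may differ from that of a covered
  -- one.
  Ready : (thr : Bool → ℕ) → Growth G → V → Set
  Ready thr S y = thr (does (Growth.covered? S y)) ≤ fresh-count S y

  -- Thresholds are positive, so each adoption covers a new vertex and the number of uncovered
  -- vertices serves as fuel.
  saturate : ∀ {ℓ} (thr : Bool → ℕ) → (∀ b → 1 ≤ thr b) → (Inv : Growth G → Set ℓ) →
    (∀ S y → Ready thr S y → Inv S → Inv (adopt S y)) →
    ∀ fuel S → count (uncovered? S) ≤ fuel → Inv S → Σ (Growth G) λ S′ → Inv S′ × (∀ y → ¬ Ready thr S′ y)
  saturate thr pos Inv preserve fuel S enough inv with any?
      (λ y → thr (does (Growth.covered? S y)) ≤? fresh-count S y)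
  ... | no none = S , inv , λ y ready → none (y , ready)
  ... | yes (y , ready) = continue fuel enough
    where
    S′ = adopt S y
    some = count-∃ (Growth.fresh? S y) (≤-trans (pos _) ready)
    x = proj₁ some
    fresh = proj₂ some
    fewer : count (uncovered? S′) < count (uncovered? S)
    fewer = count-strict (uncovered? S′) (uncovered? S) x (λ ¬c → ¬c (inj₂ (inj₁ fresh))) (proj₂ fresh)
        (λ i ¬c c → ¬c (inj₁ c))
    continue : ∀ fuel → count (uncovered? S) ≤ fuel → _
    continue zero enough = contradiction (≤-trans fewer enough) λ ()
    continue (suc fuel) enough = saturate thr pos Inv preserve fuel S′ (s≤s⁻¹ (≤-trans fewer enough))
        (preserve S y ready inv)

-- Arithmetic of the thresholds

bracket : ∀ K .{{_ : NonZero K}} d → ∃ λ e → K * e ≤ d × d < K * suc e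
bracket K d = d / K
  , ≤-trans (m≤n+m (K * (d / K)) (d % K)) (≤-reflexive (≡.sym eq))
  , ≤-trans (≤-reflexive (cong suc eq))
      (≤-trans (+-monoˡ-< (K * (d / K)) (m%n<n d K)) (≤-reflexive (≡.sym (*-suc K (d / K)))))
  where
  eq : d ≡ d % K + K * (d / K)
  eq = trans (m≡m%n+[m/n]*n d K) (cong (d % K +_) (*-comm (d / K) K))

-- As 2k ≥ 4, the squared condition gives d² - A ≥ 2B with B = 2k(k-1)n, so d² ≥ A + 2B =
-- k(k-1)(k+6)n. This exceeds 4k²n by k(k-2)(k+3)n, which vanishes at k = 2.
sqrt-bound : ∀ i n d → SqrtBound (2 + i) n d → 4 * ((2 + i) * (2 + i)) * n ≤ d * d
sqrt-bound i n d (A≤d² , root) = begin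
  4 * ((2 + i) * (2 + i)) * n           ≤⟨ m≤m+n _ ((2 + i) * (5 * i + i * i) * n) ⟩
  4 * ((2 + i) * (2 + i)) * n + (2 + i) * (5 * i + i * i) * n ≡⟨ split i n ⟩
  2 * B + A                             ≤⟨ +-monoˡ-≤ A 2B≤ ⟩
  (d ^ 2 ∸ A) + A                       ≡⟨ m∸n+n≡m A≤d² ⟩
  d ^ 2                                 ≡⟨ cong (d *_) (*-identityʳ d) ⟩
  d * d                                 ∎
  where
  open ≤-Reasoning
  k = 2 + i
  A = k * (k ∸ 1) * (k + 2) * n
  B = 2 * k * (k ∸ 1) * n
  split : ∀ i n → 4 * ((2 + i) * (2 + i)) * n + (2 + i) * (5 * i + i * i) * n
    ≡ 2 * (2 * (2 + i) * suc i * n) + (2 + i) * suc i * (2 + i + 2) * n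
  split = solve-∀
  square : ∀ b i → (2 * b) * (2 * b) + b * (b * 1) * (2 * i) ≡ b * (b * 1) * (2 * (2 + i))
  square = solve-∀
  2B≤ : 2 * B ≤ d ^ 2 ∸ A
  2B≤ = ≮⇒≥ λ lt → <⇒≱ (*-mono-< lt lt) (begin
    (2 * B) * (2 * B)                           ≤⟨ m≤m+n _ (B * (B * 1) * (2 * i)) ⟩
    (2 * B) * (2 * B) + B * (B * 1) * (2 * i)   ≡⟨ square B i ⟩
    B ^ 2 * (2 * k)                             ≤⟨ root ⟩
    (d ^ 2 ∸ A) ^ 2                             ≡⟨ cong ((d ^ 2 ∸ A) *_) (*-identityʳ _) ⟩
    (d ^ 2 ∸ A) * (d ^ 2 ∸ A)                   ∎)

-- The common form of all size estimates: a ≤ bn/h with h ≥ d/2 gives a ≤ 2bn/d, and n ≤ d²/(4P)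
-- turns this into bd/(2P).
scaled-bound : ∀ P {n d a b h} → 4 * P * n ≤ d * d → d ≤ 2 * h → 1 ≤ h → a * h ≤ b * n → 2 * P * a ≤ b * d
scaled-bound P {n} {d} {a} {b} {h@(suc _)} dense d≤2h _ ah≤bn = *-cancelʳ-≤ _ _ (2 * h) (begin
  2 * P * a * (2 * h)     ≡⟨ e₁ P a h ⟩
  4 * P * (a * h)         ≤⟨ *-monoʳ-≤ (4 * P) ah≤bn ⟩
  4 * P * (b * n)         ≡⟨ e₂ P b n ⟩
  b * (4 * P * n)         ≤⟨ *-monoʳ-≤ b dense ⟩
  b * (d * d)             ≡⟨ ≡.sym (*-assoc b d d) ⟩
  b * d * d               ≤⟨ *-monoʳ-≤ (b * d) d≤2h ⟩
  b * d * (2 * h)         ∎)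
  where
  open ≤-Reasoning
  e₁ : ∀ P a h → 2 * P * a * (2 * h) ≡ 4 * P * (a * h)
  e₁ = solve-∀
  e₂ : ∀ P b n → 4 * P * (b * n) ≡ b * (4 * P * n)
  e₂ = solve-∀

-- Here d is the minimum degree, k = 2 + i and j = k - 1.  In the first phase a root needs ρ = h - 1 = 1 + ρ₀ children
-- (h is about d / 2) and any other parent τ of them (about (1 - 1 / k²) d / 2); a vertex that this phase leaves
-- uncovered has at least g neighbours among the covered ones.
record Thresholds (i n d : ℕ) : Set where
  field
    h e τ ρ₀ g : ℕ
    h≡     : h ≡ 2 + ρ₀
    g+ρ₀   : g + ρ₀ ≡ d
    τ+e    : τ + e ≡ h
    d≤2h   : d ≤ 2 * h
    2h≤1+d : 2 * h ≤ 1 + d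
    d≤2g   : d ≤ 2 * g
    e-low  : 2 * ((2 + i) * (2 + i)) * e ≤ d
    e-high : d < 2 * ((2 + i) * (2 + i)) * suc e
    h≤2τ   : h ≤ 2 * τ
    1≤e    : 1 ≤ e
    4P≤d   : 4 * ((2 + i) * (2 + i)) ≤ d
    dense  : 4 * ((2 + i) * (2 + i)) * n ≤ d * d
  k j P : ℕ
  k = 2 + i
  j = 1 + i
  P = k * k

thresholds : ∀ i n d → 1 ≤ n → d ≤ n → 4 * ((2 + i) * (2 + i)) * n ≤ d * d → Thresholds i n d
thresholds i n@(suc _) d _ d≤n dense = record
  { h = h ; e = e ; τ = h ∸ e ; ρ₀ = h ∸ 2 ; g = d ∸ (h ∸ 2)
  ; h≡ = ≡.sym (m+[n∸m]≡n 2≤h)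
  ; g+ρ₀ = m∸n+n≡m ρ₀≤d
  ; τ+e = m∸n+n≡m e≤h
  ; d≤2h = d≤2h
  ; 2h≤1+d = proj₁ (proj₂ half)
  ; d≤2g = d≤2g
  ; e-low = e-low
  ; e-high = e-high
  ; h≤2τ = h≤2τ
  ; 1≤e = 1≤e
  ; 4P≤d = 4P≤d
  ; dense = dense
  }
  where
  open ≤-Reasoning
  P = (2 + i) * (2 + i)
  -- `h` is d/2 rounded up, so it satisfies both d ≤ 2h and 2h ≤ 1 + d.
  half = bracket 2 (1 + d)
  h = proj₁ half
  -- `e` is d/(2k²) rounded down, an eighth of d when k = 2.
  eighth = bracket (2 * P) d
  e = proj₁ eighth
  e-low = proj₁ (proj₂ eighth)
  e-high = proj₂ (proj₂ eighth)
  d≤2h : d ≤ 2 * h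
  d≤2h = s≤s⁻¹ (s≤s⁻¹ (≤-trans (proj₂ (proj₂ half)) (≤-reflexive (*-suc 2 h))))
  4P≤d : 4 * P ≤ d
  4P≤d = *-cancelʳ-≤ (4 * P) d n (≤-trans dense (*-monoʳ-≤ d d≤n))
  4≤P : 4 ≤ P
  4≤P = *-mono-≤ {2} {2 + i} {2} {2 + i} (m≤m+n 2 i) (m≤m+n 2 i)
  16≤d : 16 ≤ d
  16≤d = ≤-trans (*-monoʳ-≤ 4 4≤P) 4P≤d
  2≤h : 2 ≤ h
  2≤h = *-cancelˡ-≤ 2 (≤-trans (≤-trans (m≤m+n 4 12) 16≤d) d≤2h)
  Pe≤h : P * e ≤ h
  Pe≤h = *-cancelˡ-≤ 2 (≤-trans (≤-reflexive (≡.sym (*-assoc 2 P e))) (≤-trans e-low d≤2h))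
  2e≤h : 2 * e ≤ h
  2e≤h = ≤-trans (*-monoˡ-≤ e (≤-trans (m≤m+n 2 2) 4≤P)) Pe≤h
  e≤h : e ≤ h
  e≤h = ≤-trans (m≤m+n e _) 2e≤h
  h≤2τ : h ≤ 2 * (h ∸ e)
  h≤2τ = +-cancelʳ-≤ (2 * e) h (2 * (h ∸ e)) (begin
    h + 2 * e             ≤⟨ +-monoʳ-≤ h 2e≤h ⟩
    h + h                 ≡⟨ cong (h +_) (≡.sym (+-identityʳ h)) ⟩
    2 * h                 ≡⟨ cong (2 *_) (≡.sym (m∸n+n≡m e≤h)) ⟩
    2 * (h ∸ e + e)       ≡⟨ *-distribˡ-+ 2 (h ∸ e) e ⟩
    2 * (h ∸ e) + 2 * e   ∎)
  2ρ₀ : 2 * (h ∸ 2) + 3 ≤ d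
  2ρ₀ = +-cancelʳ-≤ 1 _ _ (begin
    2 * (h ∸ 2) + 3 + 1   ≡⟨ +-assoc (2 * (h ∸ 2)) 3 1 ⟩
    2 * (h ∸ 2) + 2 * 2   ≡⟨ ≡.sym (*-distribˡ-+ 2 (h ∸ 2) 2) ⟩
    2 * (h ∸ 2 + 2)       ≡⟨ cong (2 *_) (m∸n+n≡m 2≤h) ⟩
    2 * h                 ≤⟨ proj₁ (proj₂ half) ⟩
    1 + d                 ≡⟨ +-comm 1 d ⟩
    d + 1                 ∎)
  ρ₀≤d : h ∸ 2 ≤ d
  ρ₀≤d = ≤-trans (m≤m+n (h ∸ 2) _) (≤-trans (m≤m+n (2 * (h ∸ 2)) 3) 2ρ₀)
  d≤2g : d ≤ 2 * (d ∸ (h ∸ 2))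
  d≤2g = +-cancelʳ-≤ (2 * (h ∸ 2)) d _ (begin
    d + 2 * (h ∸ 2)                       ≤⟨ +-monoʳ-≤ d (≤-trans (m≤m+n _ 3) 2ρ₀) ⟩
    d + d                                 ≡⟨ cong (d +_) (≡.sym (+-identityʳ d)) ⟩
    2 * d                                 ≡⟨ cong (2 *_) (≡.sym (m∸n+n≡m ρ₀≤d)) ⟩
    2 * (d ∸ (h ∸ 2) + (h ∸ 2))           ≡⟨ *-distribˡ-+ 2 (d ∸ (h ∸ 2)) (h ∸ 2) ⟩
    2 * (d ∸ (h ∸ 2)) + 2 * (h ∸ 2)       ∎)
  1≤e : 1 ≤ e
  1≤e = ≰⇒> λ e≤0 → <⇒≱ e-high (begin
    2 * P * suc e ≤⟨ *-monoʳ-≤ (2 * P) (s≤s e≤0) ⟩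
    2 * P * 1     ≡⟨ *-identityʳ (2 * P) ⟩
    2 * P         ≤⟨ *-monoˡ-≤ P (m≤m+n 2 2) ⟩
    4 * P         ≤⟨ 4P≤d ⟩
    d             ∎)

module Budget {i n d : ℕ} (Th : Thresholds i n d) (N m : ℕ)
  (few-trees : 2 * Thresholds.P Th * suc N ≤ d)
  (few-left : 2 * Thresholds.P Th * m ≤ Thresholds.j Th * d) where

  open Thresholds Th
  open ≤-Reasoning

  -- The total deficit to be repaired: each of the m leftovers costs at most j where it is attached,
  -- and each of the N joining edges at most j at either end.
  Σ₀ : ℕ
  Σ₀ = m * j + N * (2 * j)

  private
    -- N joining edges come with N + 1 trees. The surplus tree yields the term 4jP, which later
    -- absorbs additive constants such as k.
    total : 2 * P * Σ₀ + 4 * j * P ≤ (j * j + 2 * j) * d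
    total = begin
      2 * P * Σ₀ + 4 * j * P                                 ≡⟨ eq P m j N ⟩
      2 * P * m * j + 2 * P * suc N * (2 * j)
          ≤⟨ +-mono-≤ (*-monoˡ-≤ j few-left) (*-monoˡ-≤ (2 * j) few-trees) ⟩
      j * d * j + d * (2 * j)                                ≡⟨ eq′ j d ⟩
      (j * j + 2 * j) * d                                    ∎
      where
      eq : ∀ P m j N → 2 * P * (m * j + N * (2 * j)) + 4 * j * P ≡ 2 * P * m * j + 2 * P * suc N * (2 * j)
      eq = solve-∀
      eq′ : ∀ j d → j * d * j + d * (2 * j) ≡ (j * j + 2 * j) * d
      eq′ = solve-∀

    P≡ : ∀ i → (1 + i) * (1 + i) + 2 * (1 + i) + 1 ≡ (2 + i) * (2 + i)
    P≡ = solve-∀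

    -- j² + 2j is one less than P = (j + 1)². The resulting spare d is the margin from which `e` is
    -- taken.
    total′ : 2 * P * Σ₀ + 4 * j * P + d ≤ P * d
    total′ = begin
      2 * P * Σ₀ + 4 * j * P + d        ≤⟨ +-monoˡ-≤ d total ⟩
      (j * j + 2 * j) * d + d           ≡⟨ eq (j * j + 2 * j) d ⟩
      (j * j + 2 * j + 1) * d           ≡⟨ cong (_* d) (P≡ i) ⟩
      P * d                             ∎
      where
      eq : ∀ a d → a * d + d ≡ (a + 1) * d
      eq = solve-∀

    Pd≤2Ph : P * d ≤ 2 * P * h
    Pd≤2Ph = ≤-trans (*-monoʳ-≤ P d≤2h) (≤-reflexive (eq P h))
      where
      eq : ∀ P h → P * (2 * h) ≡ 2 * P * h
      eq = solve-∀

  -- A non-root centre has τ children and a parent, and must keep degree above k after `Σ₀` losses.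
  -- Lowering τ from `h` by `e` spends the spare d of `total′`, by `e-low`.
  inner-rich : suc k + Σ₀ ≤ suc τ
  inner-rich = s≤s (*-cancelˡ-≤ (2 * P) (+-cancelʳ-≤ d _ _ (begin
    2 * P * (k + Σ₀) + d                             ≤⟨ m≤m+n _ (2 * i * P) ⟩
    2 * P * (k + Σ₀) + d + 2 * i * P                 ≡⟨ eq i P Σ₀ d ⟩
    2 * P * Σ₀ + 4 * j * P + d                       ≤⟨ total′ ⟩
    P * d                                            ≤⟨ Pd≤2Ph ⟩
    2 * P * h                                        ≡⟨ cong (2 * P *_) (≡.sym τ+e) ⟩
    2 * P * (τ + e)                                  ≡⟨ *-distribˡ-+ (2 * P) τ e ⟩
    2 * P * τ + 2 * P * e                            ≤⟨ +-monoʳ-≤ (2 * P * τ) e-low ⟩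
    2 * P * τ + d                                    ∎)))
    where
    eq : ∀ i P S d → 2 * P * (2 + i + S) + d + 2 * i * P ≡ 2 * P * S + 4 * (1 + i) * P + d
    eq = solve-∀

  -- A root has no parent edge to count, only its ρ₀ + 1 = h - 1 children; `4P≤d` pays for the
  -- constant lost here.
  root-rich : suc k + Σ₀ ≤ suc ρ₀
  root-rich = s≤s⁻¹ (≤-trans (*-cancelˡ-≤ (2 * P) (begin
    2 * P * (suc (suc k) + Σ₀)                       ≤⟨ m≤m+n _ (2 * i * P) ⟩
    2 * P * (suc (suc k) + Σ₀) + 2 * i * P           ≡⟨ eq i P Σ₀ ⟩
    2 * P * Σ₀ + 4 * j * P + 4 * P                   ≤⟨ +-monoʳ-≤ (2 * P * Σ₀ + 4 * j * P) 4P≤d ⟩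
    2 * P * Σ₀ + 4 * j * P + d                       ≤⟨ total′ ⟩
    P * d                                            ≤⟨ Pd≤2Ph ⟩
    2 * P * h                                        ∎)) (≤-reflexive h≡))
    where
    eq : ∀ i P S → 2 * P * (2 + (2 + i) + S) + 2 * i * P ≡ 2 * P * S + 4 * (1 + i) * P + 4 * P
    eq = solve-∀

  module _ (x : ℕ) (few-centres : 2 * P * (2 * suc N + x) ≤ 2 * d) where

    private
      2Ph≤ : 2 * P * h ≤ P * suc d
      2Ph≤ = ≤-trans (≤-reflexive (eq P h)) (*-monoʳ-≤ P 2h≤1+d)
        where
        eq : ∀ P h → 2 * P * h ≡ P * (2 * h)
        eq = solve-∀

    -- Trees are counted twice: a root may be one of the parents in the pigeonhole argument, and it
    -- is also a neighbour with no parent edge to give up. Up to constants the left side is d/k² +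
    -- (k-1)d/k² + d/2 = d/k + d/2, which is where k ≥ 2 enters.
    early-enough : 2 * suc N + x + N * (2 * j) + ρ₀ ≤ d
    early-enough = +-cancelʳ-≤ 2 _ _ (*-cancelˡ-≤ (2 * P) (+-cancelʳ-≤ (4 * j * P) _ _ (begin
      2 * P * (2 * suc N + x + N * (2 * j) + ρ₀ + 2) + 4 * j * P
        ≡⟨ eq₁ P (2 * suc N + x) N j ρ₀ ⟩
      2 * P * (2 * suc N + x) + 2 * P * suc N * (2 * j) + 2 * P * (2 + ρ₀)
        ≤⟨ +-mono-≤ (+-mono-≤ few-centres (*-monoˡ-≤ (2 * j) few-trees))
            (≤-trans (≤-reflexive (cong (2 * P *_) (≡.sym h≡))) 2Ph≤) ⟩
      2 * d + d * (2 * j) + P * suc d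
        ≤⟨ m≤m+n _ (i * k * d + 3 * P + 4 * j * P) ⟩
      2 * d + d * (2 * j) + P * suc d + (i * k * d + 3 * P + 4 * j * P)
        ≡⟨ eq₂ i d ⟩
      2 * P * (d + 2) + 4 * j * P ∎)))
      where
      eq₁ : ∀ P a N j r → 2 * P * (a + N * (2 * j) + r + 2) + 4 * j * P ≡ 2 * P * a + 2 * P * suc N *
          (2 * j) + 2 * P * (2 + r)
      eq₁ = solve-∀
      eq₂ : ∀ i d → 2 * d + d * (2 * (1 + i)) + (2 + i) * (2 + i) * suc d
        + (i * (2 + i) * d + 3 * ((2 + i) * (2 + i)) + 4 * (1 + i) * ((2 + i) * (2 + i)))
        ≡ 2 * ((2 + i) * (2 + i)) * (d + 2) + 4 * (1 + i) * ((2 + i) * (2 + i))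
      eq₂ = solve-∀

    -- Both `Σ₀` and `τ` lie about d/(2P) below d/2; the two margins together pay for the d/P
    -- allowed to `2 * suc N + x`. This needs `e` not to be rounded down too far, hence `e-high`.
    late-enough : 2 * suc N + x + Σ₀ + τ ≤ suc d
    late-enough = *-cancelˡ-≤ (2 * P) (+-cancelʳ-≤ (4 * j * P + 2 * P * e + suc d) _ _ (begin
      2 * P * (2 * suc N + x + Σ₀ + τ) + (4 * j * P + 2 * P * e + suc d)
        ≡⟨ eq₁ P (2 * suc N + x) Σ₀ τ e j d ⟩
      2 * P * (2 * suc N + x) + (2 * P * Σ₀ + 4 * j * P) + 2 * P * (τ + e) + suc d
        ≤⟨ +-mono-≤ (+-mono-≤ (+-mono-≤ few-centres total)
            (≤-trans (≤-reflexive (cong (2 * P *_) τ+e)) 2Ph≤)) e-high ⟩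
      2 * d + (j * j + 2 * j) * d + P * suc d + 2 * P * suc e
        ≤⟨ m≤m+n _ ((3 + 4 * i) * P + 1) ⟩
      2 * d + (j * j + 2 * j) * d + P * suc d + 2 * P * suc e + ((3 + 4 * i) * P + 1)
        ≡⟨ eq₂ i d e ⟩
      2 * P * suc d + (4 * j * P + 2 * P * e + suc d) ∎))
      where
      eq₁ : ∀ P a S τ e j d → 2 * P * (a + S + τ) + (4 * j * P + 2 * P * e + suc d)
        ≡ 2 * P * a + (2 * P * S + 4 * j * P) + 2 * P * (τ + e) + suc d
      eq₁ = solve-∀
      eq₂ : ∀ i d e → 2 * d + ((1 + i) * (1 + i) + 2 * (1 + i)) * d + (2 + i) * (2 + i) * suc d + 2 *
          ((2 + i) * (2 + i)) * suc e
        + ((3 + 4 * i) * ((2 + i) * (2 + i)) + 1)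
        ≡ 2 * ((2 + i) * (2 + i)) * suc d + (4 * (1 + i) * ((2 + i) * (2 + i)) + 2 * ((2 + i) * (2 + i)) * e + suc d)
      eq₂ = solve-∀

-- Weighted sums and the minimum degree

sum-*ʳ : ∀ {n} (f : Fin n → ℕ) c → sum (λ v → f v * c) ≡ sum f * c
sum-*ʳ {zero} f c = refl
sum-*ʳ {suc n} f c = trans (cong (f zero * c +_) (sum-*ʳ (f ∘ suc) c)) (≡.sym (*-distribʳ-+ c (f zero) _))

sum-bits : ∀ {n} {P : Fin n → Set} (P? : Decidable P) c → sum (λ v → bit (does (P? v)) * c) ≡ count P? * c
sum-bits P? c = sum-*ʳ (λ v → bit (does (P? v))) c

δ≤deg : ∀ {n} (G : Graph n) v → δ G ≤ deg G v
δ≤deg {n} G v = below (allFin n) (∈-allFin v)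
  where
  below : ∀ vs → v ∈ vs → foldr (λ v m → deg G v ⊓ m) n vs ≤ deg G v
  below (_ ∷ vs) (here refl) = m⊓n≤m _ _
  below (w ∷ vs) (there v∈vs) = ≤-trans (m⊓n≤n (deg G w) _) (below vs v∈vs)

δ≤n : ∀ {n} (G : Graph n) → δ G ≤ n
δ≤n {n} G = below (allFin n)
  where
  below : ∀ vs → foldr (λ v m → deg G v ⊓ m) n vs ≤ n
  below [] = ≤-refl
  below (w ∷ vs) = ≤-trans (m⊓n≤n (deg G w) _) (below vs)

-- The two greedy phases

module _ {n : ℕ} {G : Graph n} where
  private V = Fin n

  -- Being covered is part of the notion because uncovered vertices are fixed points of `par` too,
  -- without being trees of the grown forest.
  Root : Growth G → V → Set
  Root S v = Growth.Covered S v × Growth.par S v ≡ v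

  root? : ∀ S → Decidable (Root S)
  root? S v = Growth.covered? S v ×-dec (Growth.par S v ≟ v)

  -- Leaves are harmless, so only vertices with children must have many. A non-root also has its
  -- parent, so κ = k already lifts it to degree k + 1; a root has children only.
  record Shape (κ ρ : ℕ) (S : Growth G) : Set where
    open Growth S
    field
      inner : ∀ v → children v ≡ 0 ⊎ κ ≤ children v
      roots : ∀ v → Root S v → ρ ≤ children v

  open Shape

  shape-adopt : ∀ {κ ρ} (S : Growth G) y → κ ≤ ρ → (Growth.Covered S y → κ ≤ fresh-count S y) →
    (¬ Growth.Covered S y → ρ ≤ fresh-count S y) → Shape κ ρ S → Shape κ ρ (adopt S y)
  shape-adopt {κ} {ρ} S y κ≤ρ old new shape = record { inner = inner′ ; roots = roots′ }
    where
    open Growth S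
    module A = Adopt S y
    module S′ = Growth (adopt S y)
    adopted : Dec (Covered y) → κ ≤ S′.children y
    adopted (yes cy) = ≤-trans (old cy) A.children-adopter
    adopted (no ¬cy) = ≤-trans (≤-trans κ≤ρ (new ¬cy)) A.children-adopter
    inner′ : ∀ v → S′.children v ≡ 0 ⊎ κ ≤ S′.children v
    inner′ v with v ≟ y
    ... | no v≢y rewrite A.children-other v≢y = inner shape v
    ... | yes refl = inj₂ (adopted (covered? y))
    roots′ : ∀ v → Root (adopt S y) v → ρ ≤ S′.children v
    roots′ v (cov , root′) = by-cases (covered? v) (v ≟ y)
      where
      by-cases : Dec (Covered v) → Dec (v ≡ y) → ρ ≤ S′.children v
      by-cases (yes cv) _ = ≤-trans (roots shape v (cv , proj₂ (A.root-stale root′))) (A.children-mono v)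
      by-cases (no ¬cv) (yes refl) = ≤-trans (new ¬cv) A.children-adopter
      by-cases (no ¬cv) (no v≢y) = contradiction cov
        [ ¬cv , [ (λ fresh → proj₁ (A.root-stale root′) fresh) , v≢y ]′ ]′

  ready-covered : ∀ thr (S : Growth G) y → Growth.Covered S y → Ready thr S y → thr true ≤ fresh-count S y
  ready-covered thr S y cy = subst (λ b → thr b ≤ fresh-count S y) (dec-true (Growth.covered? S y) cy)

  ready-uncovered : ∀ thr (S : Growth G) y → ¬ Growth.Covered S y → Ready thr S y → thr false ≤ fresh-count S y
  ready-uncovered thr S y ¬cy = subst (λ b → thr b ≤ fresh-count S y) (dec-false (Growth.covered? S y) ¬cy)

  unready-covered : ∀ thr (S : Growth G) y → Growth.Covered S y → ¬ Ready thr S y → fresh-count S y < thr true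
  unready-covered thr S y cy ¬ready = ≰⇒>
      (¬ready ∘ subst (λ b → thr b ≤ fresh-count S y) (≡.sym (dec-true (Growth.covered? S y) cy)))

  unready-uncovered : ∀ thr (S : Growth G) y → ¬ Growth.Covered S y → ¬ Ready thr S y → fresh-count S y < thr false
  unready-uncovered thr S y ¬cy ¬ready = ≰⇒>
      (¬ready ∘ subst (λ b → thr b ≤ fresh-count S y) (≡.sym (dec-false (Growth.covered? S y) ¬cy)))

  empty-growth : Growth G
  empty-growth = record
    { rooted = record { par = id ; rank = λ _ → 0 ; root-rank = λ _ → refl ; child-rank = λ ne →
        contradiction refl ne }
    ; Covered = λ _ → ⊥
    ; covered? = λ _ → no id
    ; par-adj = λ ne → contradiction refl ne
    ; child-covered = λ ne → contradiction refl ne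
    ; parent-covered = λ ne → contradiction refl ne
    }

  empty-shape : ∀ {κ ρ} → Shape κ ρ empty-growth
  empty-shape = record
    { inner = λ v → inj₁ (count-none (Growth.child? empty-growth v) λ u (ne , eq) → ne eq)
    ; roots = λ { _ (() , _) }
    }

  first-phase : ∀ {κ ρ} → 1 ≤ κ → κ ≤ ρ →
    Σ (Growth G) λ S → Shape κ ρ S × (∀ y → ¬ Ready (λ b → if b then κ else ρ) S y)
  first-phase {κ} {ρ} 1≤κ κ≤ρ = saturate thr (λ { true → 1≤κ ; false → ≤-trans 1≤κ κ≤ρ }) (Shape κ ρ)
    (λ S y ready → shape-adopt S y κ≤ρ (λ cy → ready-covered thr S y cy ready)
        (λ ¬cy → ready-uncovered thr S y ¬cy ready))
    n empty-growth (count-≤n (uncovered? empty-growth)) empty-shape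
    where
    thr : Bool → ℕ
    thr b = if b then κ else ρ

  -- `par-same` preserves the first-phase edges, the only ones replaced later; `roots-old` says that
  -- no new tree is started, so the first phase alone bounds the number of trees.
  record Extends (S₁ S : Growth G) : Set where
    private
      module S₁ = Growth S₁
      module S = Growth S
    field
      covered-mono : ∀ {v} → S₁.Covered v → S.Covered v
      par-same     : ∀ {v} → S₁.Covered v → S.par v ≡ S₁.par v
      roots-old    : ∀ {v} → Root S v → S₁.Covered v

  open Extends

  extends-adopt : ∀ {S₁} (S : Growth G) y → Growth.Covered S y → Extends S₁ S → Extends S₁ (adopt S y)
  extends-adopt {S₁} S y cy ext = record
    { covered-mono = λ c → inj₁ (covered-mono ext c)
    ; par-same = λ c → trans (A.par-covered (covered-mono ext c)) (par-same ext c)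
    ; roots-old = λ (cov , root′) → let stale , root = A.root-stale root′ in
        roots-old ext ([ id , [ (λ fresh → contradiction fresh stale) , (λ { refl → cy }) ]′ ]′ cov , root)
    }
    where module A = Adopt S y

  -- No vertex has more than n neighbours, so with threshold suc n uncovered vertices never start a component.
  second-phase : ∀ {κ ρ S₁} → 1 ≤ κ → κ ≤ ρ → Shape κ ρ S₁ →
    Σ (Growth G) λ S → (Shape κ ρ S × Extends S₁ S) × (∀ y → ¬ Ready (λ b → if b then κ else suc n) S y)
  second-phase {κ} {ρ} {S₁} 1≤κ κ≤ρ shape = saturate thr (λ { true → 1≤κ ; false → s≤s z≤n })
    (λ S → Shape κ ρ S × Extends S₁ S)
    (λ S y ready (sh , ext) →
      let cy = must-be-covered S y ready in
      shape-adopt S y κ≤ρ (λ cy → ready-covered thr S y cy ready) (contradiction cy) sh , extends-adopt S y cy ext)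
    n S₁ (count-≤n (uncovered? S₁)) (shape , record { covered-mono = id ; par-same = λ _ → refl ; roots-old = proj₁ })
    where
    thr : Bool → ℕ
    thr b = if b then κ else suc n
    must-be-covered : ∀ (S : Growth G) y → Ready thr S y → Growth.Covered S y
    must-be-covered S y ready = by-cases (Growth.covered? S y)
      where
      by-cases : Dec (Growth.Covered S y) → Growth.Covered S y
      by-cases (yes cy) = cy
      by-cases (no ¬cy) = contradiction (ready-uncovered thr S y ¬cy ready) (≤⇒≯ (count-≤n (Growth.fresh? S y)))

-- Attaching the leftover vertices

module _ {n : ℕ} {G : Graph n} where
  private V = Fin n

  roots-and-children : (S : Growth G) → sum (Growth.children S) + count (root? S) ≤ n
  roots-and-children S = begin
    sum children + count (root? S)      ≡⟨ cong (_+ count (root? S)) children-total ⟩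
    count nonroot? + count (root? S)
        ≤⟨ count-disjoint nonroot? (root? S) (λ _ → yes tt) _ _ (λ v ne (_ , eq) → ne eq) ⟩
    count {P = λ (_ : V) → ⊤} (λ _ → yes tt) ≤⟨ count-≤n {P = λ (_ : V) → ⊤} (λ _ → yes tt) ⟩
    n                                   ∎
    where
    open Growth S
    open ≤-Reasoning
    nonroot? : Decidable (λ v → par v ≢ v)
    nonroot? v = ¬? (par v ≟ v)
    children-total : sum children ≡ count nonroot?
    children-total = trans
      (sum-cong-≗ {n} {children} {λ c → count (λ z → nonroot? z ×-dec (c ≟ par z))}
        (λ c → count-cong (child? c) (λ z → nonroot? z ×-dec (c ≟ par z))
          (λ z (ne , eq) → (λ loop → ne (trans (≡.sym loop) eq)) , ≡.sym eq)
          (λ z (ne , eq) → (λ z≡c → ne (trans (≡.sym eq) (≡.sym z≡c))) , ≡.sym eq)))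
      (count-fibres nonroot? par)

  module Attach (S₁ S₂ : Growth G) (ext : Extends S₁ S₂) (pick : V → V)
    (pick-adj : ∀ {u} → ¬ Growth.Covered S₂ u → Adj G u (pick u))
    (pick-covered : ∀ {u} → ¬ Growth.Covered S₂ u → Growth.Covered S₁ (pick u)) where

    private
      module S₁ = Growth S₁
      module S₂ = Growth S₂
    open Extends ext

    par₃ : V → V
    par₃ u = if does (S₂.covered? u) then S₂.par u else pick u

    rank₃ : V → ℕ
    rank₃ u = if does (S₂.covered? u) then S₂.rank u else suc (S₂.rank (pick u))

    choose-in : ∀ {A : Set} (x y : A) {u} → S₂.Covered u → (if does (S₂.covered? u) then x else y) ≡ x
    choose-in x y {u} cu = cong (λ b → if b then x else y) (dec-true (S₂.covered? u) cu)

    choose-out : ∀ {A : Set} (x y : A) {u} → ¬ S₂.Covered u → (if does (S₂.covered? u) then x else y) ≡ y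
    choose-out x y {u} ¬cu = cong (λ b → if b then x else y) (dec-false (S₂.covered? u) ¬cu)

    pick-≢ : ∀ {u} → ¬ S₂.Covered u → pick u ≢ u
    pick-≢ ¬cu eq = adj-irrefl G (pick-adj ¬cu) (≡.sym eq)

    par₃-in : ∀ {u} → S₂.Covered u → par₃ u ≡ S₂.par u
    par₃-in = choose-in _ _

    par₃-out : ∀ {u} → ¬ S₂.Covered u → par₃ u ≡ pick u
    par₃-out = choose-out _ _

    root-covered : ∀ {u} → par₃ u ≡ u → S₂.Covered u
    root-covered {u} root = by-cases (S₂.covered? u)
      where
      by-cases : Dec (S₂.Covered u) → S₂.Covered u
      by-cases (yes cu) = cu
      by-cases (no ¬cu) = contradiction (trans (≡.sym (par₃-out ¬cu)) root) (pick-≢ ¬cu)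

    rooted₃ : Rooted n
    rooted₃ = record
      { par = par₃
      ; rank = rank₃
      ; root-rank = λ root → let cu = root-covered root in
          trans (choose-in _ _ cu) (S₂.root-rank (trans (≡.sym (par₃-in cu)) root))
      ; child-rank = λ {v} ne → ranks v ne (S₂.covered? v)
      }
      where
      ranks : ∀ v → par₃ v ≢ v → Dec (S₂.Covered v) → rank₃ v ≡ suc (rank₃ (par₃ v))
      ranks v ne (yes cv) = let ne₂ = ne ∘ trans (par₃-in cv) in
        trans (choose-in _ _ cv) (trans (S₂.child-rank ne₂)
          (cong suc (≡.sym (trans (cong rank₃ (par₃-in cv)) (choose-in _ _ (S₂.parent-covered ne₂))))))
      ranks v ne (no ¬cv) = trans (choose-out _ _ ¬cv)
        (cong suc (≡.sym (trans (cong rank₃ (par₃-out ¬cv)) (choose-in _ _ (covered-mono (pick-covered ¬cv))))))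

    module R₃ = RootedForest rooted₃

    F : Graph n
    F = R₃.graph

    F⊆G : Subgraph F G
    F⊆G u v e = by-cases (R₃.link {u} {v} e)
      where
      up : ∀ {u} → par₃ u ≢ u → Adj G u (par₃ u)
      up {u} ne = up-cases (S₂.covered? u)
        where
        up-cases : Dec (S₂.Covered u) → Adj G u (par₃ u)
        up-cases (yes cu) = subst (Adj G u) (≡.sym (par₃-in cu)) (S₂.par-adj (ne ∘ trans (par₃-in cu)))
        up-cases (no ¬cu) = subst (Adj G u) (≡.sym (par₃-out ¬cu)) (pick-adj ¬cu)
      by-cases : R₃.Link u v → Adj G u v
      by-cases (ne , inj₁ pu≡v) = subst (Adj G u) pu≡v (up λ loop → ne (trans (≡.sym loop) pu≡v))
      by-cases (ne , inj₂ pv≡u) = adj-sym G (subst (Adj G v) pv≡u (up λ loop → ne (trans (≡.sym pv≡u) loop)))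

    attached? : ∀ v → Decidable (λ u → ¬ S₂.Covered u × v ≡ pick u)
    attached? v u = uncovered? S₂ u ×-dec (v ≟ pick u)

    attached : V → ℕ
    attached v = count (attached? v)

    children₃ : ∀ v → R₃.children v ≡ S₂.children v + attached v
    children₃ v = ≤-antisym
      (count-cover (S₂.child? v) (attached? v) (R₃.child? v) λ u child → cover u child (S₂.covered? u))
      (count-disjoint (S₂.child? v) (attached? v) (R₃.child? v)
        (λ u (ne , eq) → ne , trans (par₃-in (child-covered₂ ne eq)) eq)
        (λ u (¬cu , eq) → (λ u≡v → pick-≢ ¬cu (trans (≡.sym eq) (≡.sym u≡v))) , trans (par₃-out ¬cu) (≡.sym eq))
        (λ u (ne , eq) (¬cu , _) → ¬cu (child-covered₂ ne eq)))
      where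
      child-covered₂ : ∀ {u} → u ≢ v → S₂.par u ≡ v → S₂.Covered u
      child-covered₂ ne eq = S₂.child-covered λ loop → ne (trans (≡.sym loop) eq)
      cover : ∀ u → R₃.Child v u → Dec (S₂.Covered u) → S₂.Child v u ⊎ (¬ S₂.Covered u × v ≡ pick u)
      cover u (ne , eq) (yes cu) = inj₁ (ne , trans (≡.sym (par₃-in cu)) eq)
      cover u (ne , eq) (no ¬cu) = inj₂ (¬cu , ≡.sym (trans (≡.sym (par₃-out ¬cu)) eq))

    attached-total : sum attached ≡ count (uncovered? S₂)
    attached-total = count-fibres (uncovered? S₂) pick

    -- This is the purpose of attaching leftovers inside C: vertices outside it have no deficit
    -- until the trees are joined.
    attached-none : ∀ {v} → ¬ S₁.Covered v → attached v ≡ 0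
    attached-none ¬cv = count-none (attached? _) λ u (¬cu , v≡p) → ¬cv
        (subst S₁.Covered (≡.sym v≡p) (pick-covered ¬cu))

    root₁ : ∀ {v} → par₃ v ≡ v → Root S₁ v
    root₁ root =
      let c₂ = root-covered root
          root₂ = trans (≡.sym (par₃-in c₂)) root
          c₁ = roots-old (c₂ , root₂)
      in c₁ , trans (≡.sym (par-same c₁)) root₂

    par₃-old : ∀ {v} → S₁.Covered v → par₃ v ≡ S₁.par v
    par₃-old c₁ = trans (par₃-in (covered-mono c₁)) (par-same c₁)

    children-old : ∀ v → S₁.children v ≤ R₃.children v
    children-old v = count-mono (S₁.child? v) (R₃.child? v) λ u (ne , eq) →
      ne , trans (par₃-old (S₁.child-covered λ loop → ne (trans (≡.sym loop) eq))) eq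

    -- Roots and vertices with children already have degree above k. A childless non-root has degree
    -- 1 plus its attached leaves; the first leaf causes a deficit of at most k - 1, and further
    -- leaves only reduce it.
    deficit-attached : ∀ {k ρ} → 1 ≤ k → k < ρ → Shape k ρ S₂ → ∀ v → deficit k (deg F v) ≤ attached v * (k ∸ 1)
    deficit-attached {k} {ρ} 1≤k k<ρ shape v = by-cases (par₃ v ≟ v) (Shape.inner shape v)
      where
      large : ∀ {x} → k < x → deficit k x ≤ attached v * (k ∸ 1)
      large k<x = ≤-trans (≤-reflexive (deficit-large k<x)) z≤n
      leaf : ∀ a → deficit k (suc a) ≤ a * (k ∸ 1)
      leaf zero = z≤n
      leaf (suc a) = ≤-trans (deficit-≤ k (suc (suc a))) (m≤m+n _ _)
      by-cases : Dec (par₃ v ≡ v) → S₂.children v ≡ 0 ⊎ k ≤ S₂.children v → deficit k (deg F v) ≤ attached v * (k ∸ 1)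
      by-cases (yes root) _ = large (≤-trans k<ρ (≤-trans (Shape.roots shape v (c₂ , trans (≡.sym (par₃-in c₂)) root))
        (≤-trans (m≤m+n _ _) (≤-reflexive (≡.sym (trans (R₃.deg-root root) (children₃ v)))))))
        where c₂ = root-covered root
      by-cases (no nonroot) (inj₂ many) = large (≤-trans (s≤s (≤-trans many (m≤m+n _ (attached v))))
        (≤-reflexive (≡.sym (trans (R₃.deg-child nonroot) (cong suc (children₃ v))))))
      by-cases (no nonroot) (inj₁ none) = subst (λ x → deficit k x ≤ attached v * (k ∸ 1))
        (≡.sym (trans (R₃.deg-child nonroot) (cong suc (trans (children₃ v) (cong (_+ attached v) none)))))
            (leaf (attached v))

-- Size estimates in the given graph and assembly of the tree

weight-expand : ∀ s x h → (2 * s + x) * h ≡ 2 * (s * h) + x * h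
weight-expand = solve-∀

weight-collect : ∀ s x h τ → 2 * (s * h) + x * (2 * τ) ≡ 2 * (s * h + x * τ)
weight-collect = solve-∀

roots-twice : ∀ s x b f → s + x + b + (f + s) ≡ 2 * s + x + b + f
roots-twice = solve-∀

module Setting (i n : ℕ) (G : Graph n) (Th : Thresholds i n (δ G)) where
  open Thresholds Th
  private
    V : Set
    V = Fin n
    d : ℕ
    d = δ G
    ρ : ℕ
    ρ = suc ρ₀

  open ≤-Reasoning

  1≤d : 1 ≤ d
  1≤d = ≤-trans (s≤s z≤n) 4P≤d

  k≤τ : k ≤ τ
  -- With no leftovers and no joining edges the budget `Σ₀` is zero, and `inner-rich` becomes k + 1
  -- ≤ τ + 1.
  k≤τ = s≤s⁻¹ (≤-trans (m≤m+n (suc k) 0) (Budget.inner-rich Th 0 0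
    (≤-trans (≤-reflexive (*-identityʳ (2 * P))) (≤-trans (*-monoˡ-≤ P (m≤m+n 2 2)) 4P≤d))
    (≤-trans (≤-reflexive (*-zeroʳ (2 * P))) z≤n)))

  τ≤ρ : τ ≤ ρ
  τ≤ρ = s≤s⁻¹ (begin
    suc τ    ≡⟨ +-comm 1 τ ⟩
    τ + 1    ≤⟨ +-monoʳ-≤ τ 1≤e ⟩
    τ + e    ≡⟨ trans τ+e h≡ ⟩
    suc ρ    ∎)

  thr₁ thr₂ : Bool → ℕ
  thr₁ b = if b then τ else ρ
  thr₂ b = if b then k else suc n

  d≤deg : ∀ w → d ≤ count (neighbour? G w)
  d≤deg w = ≤-trans (δ≤deg G w) (≤-reflexive (deg≡count G w))

  1≤g : 1 ≤ g
  1≤g = ≰⇒> λ g≤0 → <⇒≱ 1≤d (≤-trans d≤2g (*-monoʳ-≤ 2 g≤0))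

  module FirstPhase (S₁ : Growth G) (done₁ : ∀ y → ¬ Ready thr₁ S₁ y) where
    private module S₁ = Growth S₁

    core? : ∀ u → Decidable (λ y → Adj G u y × S₁.Covered y)
    core? u y = neighbour? G u y ×-dec S₁.covered? y

    -- An uncovered vertex was not ready to become a root, so at most ρ₀ of its neighbours are
    -- uncovered.
    g≤core : ∀ {u} → ¬ S₁.Covered u → g ≤ count (core? u)
    g≤core {u} ¬cu = +-cancelʳ-≤ ρ₀ _ _ (begin
      g + ρ₀                                 ≡⟨ g+ρ₀ ⟩
      d                                      ≤⟨ d≤deg u ⟩
      count (neighbour? G u)
          ≤⟨ count-cover (core? u) (S₁.fresh? u) (neighbour? G u) (λ y e → cover y e (S₁.covered? y)) ⟩
      count (core? u) + fresh-count S₁ u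
          ≤⟨ +-monoʳ-≤ (count (core? u)) (s≤s⁻¹ (unready-uncovered thr₁ S₁ u ¬cu (done₁ u))) ⟩
      count (core? u) + ρ₀                   ∎)
      where
      cover : ∀ y → Adj G u y → Dec (S₁.Covered y) → (Adj G u y × S₁.Covered y) ⊎ S₁.Fresh u y
      cover y e (yes cy) = inj₁ (e , cy)
      cover y e (no ¬cy) = inj₂ (e , ¬cy)

  module Trees (1≤n : 1 ≤ n)
    (S₁ : Growth G) (shape₁ : Shape τ (suc ρ₀) S₁) (done₁ : ∀ y → ¬ Ready thr₁ S₁ y)
    (S₂ : Growth G) (shape₂ : Shape k (suc ρ₀) S₂) (ext : Extends S₁ S₂) (done₂ : ∀ y → ¬ Ready thr₂ S₂ y)
    (pick : Fin n → Fin n)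
    (pick-adj : ∀ {u} → ¬ Growth.Covered S₂ u → Adj G u (pick u))
    (pick-covered : ∀ {u} → ¬ Growth.Covered S₂ u → Growth.Covered S₁ (pick u)) where
    private
      module S₁ = Growth S₁
      module S₂ = Growth S₂
    open FirstPhase S₁ done₁
    open Extends ext
    open Attach S₁ S₂ ext pick pick-adj pick-covered

    m s N x : ℕ
    m = count (uncovered? S₂)
    s = count (root? S₁)
    N = s ∸ 1

    Centre : V → Set
    Centre c = 1 ≤ S₁.children c

    centre? : Decidable Centre
    centre? c = 1 ≤? S₁.children c

    inner? : Decidable (λ c → Centre c × S₁.par c ≢ c)
    inner? c = centre? c ×-dec ¬? (S₁.par c ≟ c)

    x = count inner?

    top-root₁ : ∀ v → Root S₁ (R₃.top v)
    top-root₁ v = root₁ (R₃.top-root v)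

    s≡ : s ≡ suc N
    s≡ = ≡.sym (m+[n∸m]≡n (count-≥1 (root? S₁) (R₃.top (fromℕ< 1≤n)) (top-root₁ (fromℕ< 1≤n))))

    centre-τ : ∀ {c} → Centre c → τ ≤ S₁.children c
    centre-τ {c} 1≤ = [ (λ none → contradiction (≤-reflexive none) (<⇒≱ 1≤)) , id ]′ (Shape.inner shape₁ c)

    centres≤ : count centre? ≤ s + x
    centres≤ = count-cover (root? S₁) inner? centre? λ c 1≤ → cover c 1≤ (S₁.par c ≟ c)
      where
      cover : ∀ c → Centre c → Dec (S₁.par c ≡ c) → Root S₁ c ⊎ (Centre c × S₁.par c ≢ c)
      cover c 1≤ (no nonroot) = inj₂ (1≤ , nonroot)
      cover c 1≤ (yes root) = let u , u≢c , pu≡c = count-∃ (S₁.child? c) 1≤ in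
        inj₁ (subst S₁.Covered pu≡c (S₁.parent-covered λ loop → u≢c (trans (≡.sym loop) pu≡c)) , root)

    -- A root accounts for itself and ρ children, together h = ρ + 1 vertices. Any other centre
    -- accounts for its children only, being itself a child. No vertex is charged twice.
    weights : s * h + x * τ ≤ n
    weights = begin
      s * h + x * τ
        ≡⟨ cong₂ _+_ (≡.sym (sum-bits (root? S₁) h)) (≡.sym (sum-bits inner? τ)) ⟩
      sum rootWeight + sum innerWeight
        ≡⟨ ≡.sym (∑-distrib-+ {n} rootWeight innerWeight) ⟩
      sum (λ v → rootWeight v + innerWeight v)
        ≤⟨ sum-mono (λ v → pointwise v (root? S₁ v) (inner? v)) ⟩
      sum (λ v → S₁.children v + bit (does (root? S₁ v)))
        ≡⟨ ∑-distrib-+ {n} S₁.children (λ v → bit (does (root? S₁ v))) ⟩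
      sum S₁.children + s
        ≤⟨ roots-and-children S₁ ⟩
      n ∎
      where
      rootWeight innerWeight : V → ℕ
      rootWeight v = bit (does (root? S₁ v)) * h
      innerWeight v = bit (does (inner? v)) * τ
      pointwise : ∀ v (r : Dec (Root S₁ v)) (c : Dec (Centre v × S₁.par v ≢ v)) →
        bit (does r) * h + bit (does c) * τ ≤ S₁.children v + bit (does r)
      pointwise v (yes (_ , root)) (yes (_ , nonroot)) = contradiction root nonroot
      pointwise v (yes root) (no _) = begin
        1 * h + 0                ≡⟨ trans (+-identityʳ (1 * h)) (*-identityˡ h) ⟩
        h                        ≡⟨ h≡ ⟩
        suc ρ                    ≤⟨ s≤s (Shape.roots shape₁ v root) ⟩
        suc (S₁.children v)      ≡⟨ +-comm 1 _ ⟩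
        S₁.children v + 1        ∎
      pointwise v (no _) (yes (centre , _)) = begin
        1 * τ                    ≡⟨ *-identityˡ τ ⟩
        τ                        ≤⟨ centre-τ centre ⟩
        S₁.children v            ≤⟨ m≤m+n _ 0 ⟩
        S₁.children v + 0        ∎
      pointwise v (no _) (no _) = z≤n

    -- The edges between leftovers and C are counted from both sides. A vertex of C sees at most j =
    -- k - 1 leftovers, since otherwise it would have adopted them in the second phase.
    leftovers : m * g ≤ j * n
    leftovers = begin
      m * g                                     ≡⟨ ≡.sym (sum-bits (uncovered? S₂) g) ⟩
      sum (λ u → bit (does (uncovered? S₂ u)) * g)  ≤⟨ sum-mono (λ u → out u (uncovered? S₂ u)) ⟩
      sum (λ u → count (λ y → R? u y))          ≡⟨ count-swap R? ⟩
      sum (λ y → count (λ u → R? u y))          ≤⟨ sum-≤ j into ⟩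
      n * j                                     ≡⟨ *-comm n j ⟩
      j * n                                     ∎
      where
      R? : ∀ u y → Dec (¬ S₂.Covered u × (Adj G u y × S₁.Covered y))
      R? u y = uncovered? S₂ u ×-dec core? u y
      out : ∀ u (c : Dec (¬ S₂.Covered u)) → bit (does c) * g ≤ count (λ y → R? u y)
      out u (no _) = z≤n
      out u (yes ¬cu) = ≤-trans (≤-reflexive (*-identityˡ g)) (≤-trans (g≤core (¬cu ∘ covered-mono))
        (count-mono (core? u) (R? u) λ y c → ¬cu , c))
      into : ∀ y → count (λ u → R? u y) ≤ j
      into y = by-cases (S₁.covered? y)
        where
        by-cases : Dec (S₁.Covered y) → count (λ u → R? u y) ≤ j
        by-cases (no ¬cy) = ≤-trans (≤-reflexive (count-none (λ u → R? u y) λ u (_ , _ , cy) → ¬cy cy)) z≤n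
        by-cases (yes cy) = ≤-trans
          (count-mono (λ u → R? u y) (S₂.fresh? y) λ u (¬cu , e , _) → adj-sym G e , ¬cu)
          (s≤s⁻¹ (unready-covered thr₂ S₂ y (covered-mono cy) (done₂ y)))

    1≤h : 1 ≤ h
    1≤h = ≤-trans (s≤s z≤n) (≤-reflexive (≡.sym h≡))

    few-trees : 2 * P * suc N ≤ d
    few-trees = begin
      2 * P * suc N   ≡⟨ cong (2 * P *_) (≡.sym s≡) ⟩
      2 * P * s       ≤⟨ scaled-bound P {n} {d} {s} {1} dense d≤2h 1≤h
          (≤-trans (≤-trans (m≤m+n _ _) weights) (≤-reflexive (≡.sym (*-identityˡ n)))) ⟩
      1 * d           ≡⟨ *-identityˡ d ⟩
      d               ∎

    few-left : 2 * P * m ≤ j * d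
    few-left = scaled-bound P {n} {d} {m} {j} dense d≤2g 1≤g leftovers

    -- The factor 2 on the right both pays for counting the roots twice and compensates for τ being
    -- only at least h/2.
    few-centres : 2 * P * (2 * suc N + x) ≤ 2 * d
    few-centres = scaled-bound P {n} {d} {2 * suc N + x} {2} dense d≤2h 1≤h (begin
      (2 * suc N + x) * h        ≡⟨ cong (λ t → (2 * t + x) * h) (≡.sym s≡) ⟩
      (2 * s + x) * h            ≡⟨ weight-expand s x h ⟩
      2 * (s * h) + x * h        ≤⟨ +-monoʳ-≤ (2 * (s * h)) (*-monoʳ-≤ x h≤2τ) ⟩
      2 * (s * h) + x * (2 * τ)  ≡⟨ weight-collect s x h τ ⟩
      2 * (s * h + x * τ)        ≤⟨ *-monoʳ-≤ 2 weights ⟩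
      2 * n                      ∎)

    open Budget Th N m few-trees few-left

    module Final (T₀ : Graph n) (spanning : SpanningTree G T₀) (F⊆T₀ : Subgraph F T₀)
      (joined-short : ∀ Q → shortage k Q T₀ ≤ shortage k Q F + N * (2 * j)) where

      -- Membership is measured by the first phase, even for vertices adopted in the second, because
      -- only first-phase parent edges are moved.
      outside : V → Bool
      outside v = not (does (S₁.covered? v))

      outside-uncovered : ∀ {v} → Data.Bool.T (outside v) → ¬ S₁.Covered v
      outside-uncovered {v} = from-does (¬? (S₁.covered? v))

      inside-covered : ∀ {v} → Data.Bool.T (not (outside v)) → S₁.Covered v
      inside-covered {v} t with S₁.covered? v
      ... | yes cv = cv

      open Stealing k G S₁.par centre? outside

      F-deficit : ∀ v → deficit k (deg F v) ≤ attached v * j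
      F-deficit = deficit-attached (s≤s z≤n) (≤-trans (m≤m+n (suc k) Σ₀) root-rich) shape₂

      early-F : early F ≡ 0
      early-F = shortage-none outside F λ (v , out , pos) → <⇒≱ pos
        (≤-trans (F-deficit v) (≤-reflexive (cong (_* j) (attached-none (outside-uncovered out)))))

      all-F : shortage k (λ _ → true) F ≤ m * j
      all-F = begin
        sum (λ v → deficit k (deg F v))  ≤⟨ sum-mono F-deficit ⟩
        sum (λ v → attached v * j)       ≡⟨ sum-*ʳ attached j ⟩
        sum attached * j                 ≡⟨ cong (_* j) attached-total ⟩
        m * j                            ∎

      early≤ : early T₀ ≤ N * (2 * j)
      early≤ = ≤-trans (joined-short outside) (≤-reflexive (cong (_+ N * (2 * j)) early-F))

      both≤ : early T₀ + late T₀ ≤ Σ₀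
      both≤ = begin
        early T₀ + late T₀                       ≡⟨ ≡.sym (∑-distrib-+ {n} (term outside) (term (not ∘ outside))) ⟩
        sum (λ v → term outside v + term (not ∘ outside) v)
            ≡⟨ sum-cong-≗ {n} {λ v → term outside v + term (not ∘ outside) v} {term (λ _ → true)}
                (λ v → split (outside v) (deficit k (deg T₀ v))) ⟩
        shortage k (λ _ → true) T₀               ≤⟨ joined-short (λ _ → true) ⟩
        shortage k (λ _ → true) F + N * (2 * j)  ≤⟨ +-monoˡ-≤ (N * (2 * j)) all-F ⟩
        Σ₀                                       ∎
        where
        term : (V → Bool) → V → ℕ
        term Q v = if Q v then deficit k (deg T₀ v) else 0
        split : ∀ b t → (if b then t else 0) + (if not b then t else 0) ≡ t
        split true t = +-identityʳ t
        split false t = refl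

      active? : Decidable (λ z → S₁.Covered z × S₁.par z ≢ z)
      active? z = S₁.covered? z ×-dec ¬? (S₁.par z ≟ z)

      degree-split : ∀ w → d ≤ count (reachable? active? w) + (fresh-count S₁ w + s)
      degree-split w = begin
        d                                     ≤⟨ d≤deg w ⟩
        count (neighbour? G w)
            ≤⟨ count-cover (reachable? active? w) rest? (neighbour? G w)
                (λ z e → cover z e (S₁.covered? z) (S₁.par z ≟ z)) ⟩
        count (reachable? active? w) + count rest?
          ≤⟨ +-monoʳ-≤ (count (reachable? active? w)) (count-cover (S₁.fresh? w) (root? S₁) rest? (λ _ → id)) ⟩
        count (reachable? active? w) + (fresh-count S₁ w + s) ∎
        where
        rest? : Decidable (λ z → S₁.Fresh w z ⊎ Root S₁ z)
        rest? z = S₁.fresh? w z ⊎-dec root? S₁ z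
        cover : ∀ z → Adj G w z → Dec (S₁.Covered z) → Dec (S₁.par z ≡ z) →
          (Adj G w z × S₁.Covered z × S₁.par z ≢ z) ⊎ (S₁.Fresh w z ⊎ Root S₁ z)
        cover z e (no ¬cz) _ = inj₂ (inj₁ (e , ¬cz))
        cover z e (yes cz) (yes root) = inj₂ (inj₂ (cz , root))
        cover z e (yes cz) (no nonroot) = inj₁ (e , cz , nonroot)

      centre-deg : ∀ c → Centre c → suc k + Σ₀ ≤ deg F c
      centre-deg c centre = by-cases (par₃ c ≟ c)
        where
        by-cases : Dec (par₃ c ≡ c) → suc k + Σ₀ ≤ deg F c
        by-cases (yes root) = ≤-trans root-rich (≤-trans (Shape.roots shape₁ c (root₁ root))
          (≤-trans (children-old c) (≤-reflexive (≡.sym (R₃.deg-root root)))))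
        by-cases (no nonroot) = ≤-trans inner-rich (≤-trans (s≤s (≤-trans (centre-τ centre) (children-old c)))
          (≤-reflexive (≡.sym (R₃.deg-child nonroot))))

      deg-F≤T₀ : ∀ c → deg F c ≤ deg T₀ c
      deg-F≤T₀ c = begin
        deg F c                   ≡⟨ deg≡count F c ⟩
        count (neighbour? F c)    ≤⟨ count-mono (neighbour? F c) (neighbour? T₀ c) (F⊆T₀ c) ⟩
        count (neighbour? T₀ c)   ≡⟨ ≡.sym (deg≡count T₀ c) ⟩
        deg T₀ c                  ∎

      stock : Stock T₀
      stock = record
        { spanning = spanning
        ; act? = active?
        ; at-home = λ z (cz , nonroot) → F⊆T₀ z (S₁.par z) (R₃.unlink (nonroot ∘ ≡.sym , inj₁ (par₃-old cz)))
        ; home-centre = λ z (cz , nonroot) → count-≥1 (S₁.child? (S₁.par z)) z (nonroot ∘ ≡.sym , refl)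
        ; home-twice = λ z (cz , nonroot) → RootedForest.par-par S₁.rooted nonroot
        ; rich = λ c centre → ≤-trans (+-monoʳ-≤ (suc k) both≤) (≤-trans (centre-deg c centre) (deg-F≤T₀ c))
        -- A vertex outside C may have as many as ρ₀ uncovered neighbours but competes only with the
        -- deficits of joining edges; a vertex of C has fewer than τ and competes with all of `Σ₀`.
        ; plenty-early = λ w out _ → plenty w (early T₀) (N * (2 * j)) early≤ ρ₀
            (s≤s⁻¹ (unready-uncovered thr₁ S₁ w (outside-uncovered out) (done₁ w))) (early-enough x few-centres)
        ; plenty-late = λ w inn → plenty-strict w (unready-covered thr₁ S₁ w (inside-covered inn) (done₁ w))
        }
        where
        plenty : ∀ w a b → a ≤ b → ∀ f → fresh-count S₁ w ≤ f → 2 * suc N + x + b + f ≤ d →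
          count centre? + a ≤ count (reachable? active? w)
        plenty w a b a≤b f fresh≤f enough = +-cancelʳ-≤ (f + s) _ _ (begin
          count centre? + a + (f + s)           ≤⟨ +-monoˡ-≤ (f + s) (+-mono-≤ centres≤ a≤b) ⟩
          s + x + b + (f + s)                   ≡⟨ roots-twice s x b f ⟩
          2 * s + x + b + f                     ≡⟨ cong (λ t → 2 * t + x + b + f) s≡ ⟩
          2 * suc N + x + b + f                 ≤⟨ enough ⟩
          d                                     ≤⟨ degree-split w ⟩
          count (reachable? active? w) + (fresh-count S₁ w + s)
            ≤⟨ +-monoʳ-≤ (count (reachable? active? w)) (+-monoˡ-≤ s fresh≤f) ⟩
          count (reachable? active? w) + (f + s) ∎)
        plenty-strict : ∀ w → fresh-count S₁ w < τ → count centre? + (early T₀ + late T₀) ≤ count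
            (reachable? active? w)
        plenty-strict w fresh<τ = plenty w (early T₀ + late T₀) Σ₀ both≤ (fresh-count S₁ w) ≤-refl
          (s≤s⁻¹ (≤-trans (≤-trans (≤-reflexive (≡.sym (+-suc (2 * suc N + x + Σ₀) (fresh-count S₁ w))))
              (+-monoʳ-≤ (2 * suc N + x + Σ₀) fresh<τ)) (late-enough x few-centres)))

      result : Has2kST k G
      result =
        let T , tree , perfect = steal-all (early T₀ + late T₀) stock refl
            open SpanningTree tree
        in T , (within , connected , forest-acyclic {F = T} forest) , λ v → deficit-zero {d = deg T v} (perfect v)

    conclude : Connected G → Has2kST k G
    conclude connected =
      let T₀ , spanning , F⊆T₀ , joined-short =
            join-components k connected N F⊆G R₃.forest R₃.components (root? S₁) top-root₁ (≤-reflexive s≡)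
      in Final.result T₀ spanning F⊆T₀ joined-short

choose-if : ∀ {n} {U : Fin n → Set} {R : Fin n → Fin n → Set} → Decidable U → (∀ u → U u → ∃ (R u)) →
  Σ (Fin n → Fin n) λ f → ∀ u → U u → R u (f u)
choose-if {U = U} {R} U? ex = (λ u → by (U? u)) , λ u p → spec u (U? u) p
  where
  by : ∀ {u} → Dec (U u) → Fin _
  by {u} (yes p) = proj₁ (ex u p)
  -- An arbitrary value: the specification concerns only points of `U`.
  by {u} (no _) = u
  spec : ∀ u (u? : Dec (U u)) → U u → R u (by u?)
  spec u (yes p) _ = proj₂ (ex u p)
  spec u (no ¬p) p = contradiction p ¬p

theorem1 : (k n : ℕ) → 2 ≤ k → 1 ≤ n → (G : Graph n) → Connected G →
    SqrtBound k n (δ G) → Has2kST k G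
theorem1 (suc zero) n (s≤s ()) _ _ _ _
theorem1 (suc (suc i)) n _ 1≤n G connected bound = build
    (thresholds i n (δ G) 1≤n (δ≤n G) (sqrt-bound i n (δ G) bound))
  where
  build : Thresholds i n (δ G) → Has2kST (2 + i) G
  build Th = grow (first-phase (≤-trans (s≤s z≤n) k≤τ) τ≤ρ)
    where
    open Setting i n G Th
    open Thresholds Th using (k; τ; ρ₀)
    grow : (Σ (Growth G) λ S₁ → Shape τ (suc ρ₀) S₁ × (∀ y → ¬ Ready thr₁ S₁ y)) → Has2kST k G
    grow (S₁ , shape₁ , done₁) = adopt-rest (second-phase (s≤s z≤n) (≤-trans k≤τ τ≤ρ) (record
        { inner = λ v → map₂ (≤-trans k≤τ) (Shape.inner shape₁ v) ; roots = Shape.roots shape₁ }))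
      where
      open FirstPhase S₁ done₁
      adopt-rest : (Σ (Growth G) λ S₂ → (Shape k (suc ρ₀) S₂ × Extends S₁ S₂) × (∀ y → ¬ Ready thr₂ S₂ y)) →
          Has2kST k G
      adopt-rest (S₂ , (shape₂ , ext) , done₂) = attach
        (choose-if (uncovered? S₂) λ u ¬cu → count-∃ (core? u)
            (≤-trans 1≤g (g≤core (¬cu ∘ Extends.covered-mono ext))))
        where
        attach : (Σ (Fin n → Fin n) λ pick → ∀ u → ¬ Growth.Covered S₂ u → Adj G u (pick u) × Growth.Covered S₁
            (pick u)) → Has2kST k G
        attach (pick , spec) = Trees.conclude 1≤n S₁ shape₁ done₁ S₂ shape₂ ext done₂ pick
          (λ {u} ¬cu → proj₁ (spec u ¬cu)) (λ {u} ¬cu → proj₂ (spec u ¬cu)) connected
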